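{- Let $\mathbf X,\mathbf Y,\mathbf Z$ be represented spaces, and let $\mathbf Y$ be effectively traceable. Then the following operations are computable: \begin{enumerate} \item $\circ:\mathcal M(\mathbf Y,\mathbf Z)\times\mathcal M(\mathbf X,\mathbf Y)\to\mathcal M(\mathbf X,\mathbf Z)$, $(f,g)\mapsto f\circ g$; \item $\mathrm{Curry}:\mathcal M(\mathbf Y\times\mathbf X,\mathbf Z)\to\mathcal C(\mathbf Y,\mathcal M(\mathbf X,\mathbf Z))$, $\mathrm{Curry}(f)(y)(x):=f(y,x)$. \end{enumerate}
   Context: A represented space $\mathbf X=(X,\delta_X)$ is a set $X$ with a partial surjection $\delta_X:\subseteq\mathbb N^{\mathbb N}\to X$ (the symbol $\subseteq$ marks possibly partial functions). A multi-valued function $f:\subseteq\mathbf X\rightrightarrows\mathbf Y$ assigns to each $x\in\mathrm{dom}(f)\subseteq X$ a nonempty set $f(x)\subseteq Y$. Composition: $z\in(f\circ g)(x)$ iff $g(x)\subseteq\mathrm{dom}(f)$ and $z\in f(y)$ for some $y\in g(x)$ (with $x\in\mathrm{dom}(g)$). $F:\subseteq\mathbb N^{\mathbb N}\to\mathbb N^{\mathbb N}$ is a realizer of $f$ if $\delta_YF(p)\in f\delta_X(p)$ for all $p\in\mathrm{dom}(f\delta_X)$; $f$ is computable (continuous) if it has a computable (continuous) realizer. Products are represented by $\delta_{X\times Y}\langle p,q\rangle=(\delta_X(p),\delta_Y(q))$. Fix a universal Turing machine; $\Phi_p:\subseteq\mathbb N^{\mathbb N}\to\mathbb N^{\mathbb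 N}$ is defined by $\Phi_p(q)=r$ iff on input $\langle p,q\rangle$ the machine writes infinitely often on the output tape, producing $r$. $\mathcal C(\mathbf X,\mathbf Y)$ is the represented space of total continuous (single-valued) functions $f:X\to Y$, $p$ being a name of $f$ if $\Phi_p$ is a realizer of $f$. Let $\delta_X^{\mathrm{cyl}}\langle p,q\rangle:=\delta_X(p)$ and $\Phi_p^{\mathbf X,\mathbf Y}:=\delta_Y\circ\Phi_p\circ(\delta_X^{\mathrm{cyl}})^{ -1}:\subseteq\mathbf X\rightrightarrows\mathbf Y$; explicitly, $x\in\mathrm{dom}(\Phi_p^{\mathbf X,\mathbf Y})$ iff $\Phi_p(q)$ is defined and in $\mathrm{dom}(\delta_Y)$ for all $q\in\langle\delta_X^{ -1}\{x\}\times\mathbb N^{\mathbb N}\rangle$, and then $\Phi_p^{\mathbf X,\mathbf Y}(x)=\{\delta_Y\Phi_p(q):q\in\langle\delta_X^{ -1}\{x\}\times\mathbb N^{\mathbb N}\rangle\}$. $\mathcal M(\mathbf X,\mathbf Y)$ is the represented space of all $\Phi_p^{\mathbf X,\mathbf Y}$ (strongly continuous multi-valued functions), $p$ being a name of $\Phi_p^{\mathbf X,\mathbf Y}$. A representation $\delta_X:\subseteq\mathbb N^{\mathbb N}\to X$ is effectively traceable if there is a computable $T:\subseteq\mathbb N^{\mathbb N}\times\mathbb N^{\mathbb N}\to\mathbb N^{\mathbb N}$ with $\mathrm{dom}(T)=\mathrm{dom}(\delta_X)\times\mathbb N^{\mathbb N}$ and $\{T(p,q):q\in\mathbb N^{\mathbb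 N}\}=\delta_X^{ -1}(\delta_X(p))$ for all $p\in\mathrm{dom}(\delta_X)$. A represented space is effectively traceable if its representation is. -}

module Defs where

open import Level using (Level; _⊔_; suc)
open import Data.Empty using (⊥-elim)
open import Data.Fin.Base using (Fin)
open import Data.List.Base using (List; []; _∷_; _++_; _∷ʳ_; length; applyUpTo)
open import Data.List.Properties
  using (++-assoc; ++-identityʳ; length-++; length-applyUpTo; applyUpTo-∷ʳ; ∷ʳ-injectiveʳ)
open import Data.Maybe.Base using (Maybe; nothing)
open import Data.Bool.Base using (Bool)
open import Data.Nat.Base as ℕ using (ℕ; zero; _+_; _∸_; _≤_)
open import Data.Nat.Properties using (m∸n+n≡m; ≤-total; m+1+n≢m)
open import Data.Product.Base using (Σ-syntax; ∃-syntax; _×_; _,_; proj₁; proj₂)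
open import Data.Product.Relation.Binary.Pointwise.NonDependent using (×-setoid)
open import Data.Sum.Base using (inj₁; inj₂)
open import Data.Vec.Functional using (Vector; updateAt)
open import Function.Base using (_∘_; const)
open import Function.Bundles using (_⇔_; mk⇔; Func; _⟨$⟩_)
open import Function.Properties.Equivalence using (⇔-isEquivalence)
import Function.Relation.Binary.Setoid.Equality as FuncEquality
open import Relation.Binary.Bundles using (Setoid)
open import Relation.Binary.Structures using (IsEquivalence)
import Relation.Binary.Construct.On as On
open import Relation.Binary.PropositionalEquality
  using (_≡_; _≗_; refl; sym; trans; cong; cong₂)

private
  variable
    a b c a₁ a₂ a₃ b₁ b₂ b₃ c₁ c₂ c₃ v w : Level

Baire : Set
Baire = ℕ → ℕ

tail : Baire → Baire
tail p n = p (ℕ.suc n)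

infixr 5 _◂_
_◂_ : ℕ → Baire → Baire
(n ◂ p) zero      = n
(n ◂ p) (ℕ.suc i) = p i

-- ⟨ p , q ⟩ = p 0 , q 0 , p 1 , q 1 , …
⟨_,_⟩ : Baire → Baire → Baire
⟨ p , q ⟩ zero      = p 0
⟨ p , q ⟩ (ℕ.suc n) = ⟨ q , tail p ⟩ n

⟨,⟩-cong : ∀ {p p′ q q′} → p ≗ p′ → q ≗ q′ → ⟨ p , q ⟩ ≗ ⟨ p′ , q′ ⟩
⟨,⟩-cong e f zero      = e 0
⟨,⟩-cong e f (ℕ.suc n) = ⟨,⟩-cong f (e ∘ ℕ.suc) n

⟨,⟩-injectiveˡ : ∀ {p p′ q q′} → ⟨ p , q ⟩ ≗ ⟨ p′ , q′ ⟩ → p ≗ p′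
⟨,⟩-injectiveˡ e zero      = e 0
⟨,⟩-injectiveˡ {p} {p′} {q} {q′} e (ℕ.suc n) =
  ⟨,⟩-injectiveˡ {tail p} {tail p′} {tail q} {tail q′} (e ∘ ℕ.suc ∘ ℕ.suc) n

⟨,⟩-injectiveʳ : ∀ {p p′ q q′} → ⟨ p , q ⟩ ≗ ⟨ p′ , q′ ⟩ → q ≗ q′
⟨,⟩-injectiveʳ {p} {p′} {q} {q′} e =
  ⟨,⟩-injectiveˡ {q} {q′} {tail p} {tail p′} (e ∘ ℕ.suc)

-- Numbers are presented on the input and output tapes in unary: n is
-- written as n strokes followed by a comma.
data Glyph : Set where
  stroke comma : Glyph

-- A one-way reading head is represented by the part of the input it has
-- not passed yet; if it stands inside a block, the first number of that
-- part is the number of strokes left in the block.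
next : Baire → Glyph × Baire
next p with p 0
... | zero    = comma  , tail p
... | ℕ.suc n = stroke , n ◂ tail p

-- Work tape alphabet {0 , 1} with blank 'nothing'.
Symbol : Set
Symbol = Maybe Bool

-- A two-way infinite work tape: cells left of the head (nearest first),
-- scanned cell, cells right of the head; all further cells are blank.
record Tape : Set where
  constructor tape
  field
    before  : List Symbol
    scanned : Symbol
    after   : List Symbol

blank : Tape
blank = tape [] nothing []

data Direction : Set where
  left right : Direction

write : Symbol → Tape → Tape
write s (tape l _ r) = tape l s r

move : Direction → Tape → Tape
move left  (tape []      s r)       = tape [] nothing (s ∷ r)
move left  (tape (x ∷ l) s r)       = tape l x (s ∷ r)
move right (tape l       s [])      = tape (s ∷ l) nothing []
move right (tape l       s (x ∷ r)) = tape (s ∷ l) x r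

-- Machines are given by flowcharts.  The input tape is read-only and is
-- scanned by finitely many independent one-way heads; the output tape is
-- one-way and write-only.
data Instruction (states heads tapes : ℕ) : Set where
  readInput : Fin heads → (Glyph → Fin states) → Instruction states heads tapes
  branchOn  : Fin tapes → (Symbol → Fin states) → Instruction states heads tapes
  writeTape : Fin tapes → Symbol → Fin states → Instruction states heads tapes
  moveTape  : Fin tapes → Direction → Fin states → Instruction states heads tapes
  print     : Glyph → Fin states → Instruction states heads tapes

record Machine : Set where
  field
    states heads tapes : ℕ
    start   : Fin states
    program : Fin states → Instruction states heads tapes

-- The output tape consists of the completed blocks 'written' and of
-- 'pending' strokes after the last comma.
record Configuration (M : Machine) : Set where
  constructor config
  open Machine M
  field
    state   : Fin states
    inputs  : Vector Baire heads
    works   : Vector Tape tapes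
    written : List ℕ
    pending : ℕ

module _ (M : Machine) where
  open Machine M

  initial : Baire → Configuration M
  initial p = config start (const p) (const blank) [] 0

  execute : Instruction states heads tapes → Configuration M → Configuration M
  execute (readInput h k) (config _ i t o n) =
    config (k (proj₁ (next (i h)))) (updateAt i h (proj₂ ∘ next)) t o n
  execute (branchOn j k) (config _ i t o n) =
    config (k (Tape.scanned (t j))) i t o n
  execute (writeTape j s q) (config _ i t o n) =
    config q i (updateAt t j (write s)) o n
  execute (moveTape j d q) (config _ i t o n) =
    config q i (updateAt t j (move d)) o n
  execute (print stroke q) (config _ i t o n) =
    config q i t o (ℕ.suc n)
  execute (print comma q) (config _ i t o n) =
    config q i t (o ∷ʳ n) 0

  step : Configuration M → Configuration M
  step C = execute (program (Configuration.state C)) C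

  run : Baire → ℕ → Configuration M
  run p zero      = initial p
  run p (ℕ.suc t) = step (run p t)

  output : Baire → ℕ → List ℕ
  output p t = Configuration.written (run p t)

-- M ⊢ p ↦ r : on input p, M writes infinitely many numbers, namely r.
-- M ⊢_↦_ is the graph of the partial function computed by M; its domain
-- consists of exactly those p on which M writes infinitely many numbers.
infix 4 _⊢_↦_
_⊢_↦_ : Machine → Baire → Baire → Set
M ⊢ p ↦ r = ∀ n → ∃[ t ] output M p t ≡ applyUpTo r n

-- U simulates every machine M: a parameter p for M is computably turned
-- (by attaching a code of M) into a first argument s for U such that U
-- and M behave in the same way, which includes writing infinitely many
-- numbers or not.  How codes are attached is left open.
Universal : Machine → Set
Universal U = ∀ (M : Machine) → Σ[ S ∈ Machine ] (∀ p → ∃[ s ]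
  (S ⊢ p ↦ s) × (∀ q r → (U ⊢ ⟨ s , q ⟩ ↦ r) ⇔ (M ⊢ ⟨ p , q ⟩ ↦ r)))

-- _⊢_↦_ respects pointwise equality and is single-valued.

private
  next-cong : ∀ {p q} → p ≗ q →
    proj₁ (next p) ≡ proj₁ (next q) × proj₂ (next p) ≗ proj₂ (next q)
  next-cong {p} {q} e with p 0 | q 0 | e 0
  ... | zero    | _ | refl = refl , e ∘ ℕ.suc
  ... | ℕ.suc n | _ | refl = refl , λ { zero → refl ; (ℕ.suc i) → e (ℕ.suc i) }

  updateAt-cong : ∀ {n} (i j : Vector Baire n) (f : Baire → Baire) →
    (∀ {p q} → p ≗ q → f p ≗ f q) → (∀ g → i g ≗ j g) →
    ∀ h g → updateAt i h f g ≗ updateAt j h f g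
  updateAt-cong i j f fc e Fin.zero    Fin.zero    = fc (e Fin.zero)
  updateAt-cong i j f fc e Fin.zero    (Fin.suc g) = e (Fin.suc g)
  updateAt-cong i j f fc e (Fin.suc h) Fin.zero    = e Fin.zero
  updateAt-cong i j f fc e (Fin.suc h) (Fin.suc g) =
    updateAt-cong (i ∘ Fin.suc) (j ∘ Fin.suc) f fc (e ∘ Fin.suc) h g

  data Similar {M : Machine} : Configuration M → Configuration M → Set where
    similar : ∀ {q i j t o n} → (∀ h → i h ≗ j h) →
      Similar (config q i t o n) (config q j t o n)

  execute-cong : ∀ M I {C D} → Similar {M} C D →
    Similar (execute M I C) (execute M I D)
  execute-cong M (readInput h k) (similar {i = i} {j} e)
    with proj₁ (next (i h)) | proj₁ (next (j h)) | proj₁ (next-cong (e h))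
  ... | _ | _ | refl =
    similar (updateAt-cong i j (proj₂ ∘ next) (proj₂ ∘ next-cong) e h)
  execute-cong M (branchOn j k)     (similar e) = similar e
  execute-cong M (writeTape j s q)  (similar e) = similar e
  execute-cong M (moveTape j d q)   (similar e) = similar e
  execute-cong M (print stroke q)   (similar e) = similar e
  execute-cong M (print comma q)    (similar e) = similar e

  step-cong : ∀ {M C D} → Similar {M} C D → Similar (step M C) (step M D)
  step-cong {M} s@(similar {q} e) = execute-cong M (Machine.program M q) s

  run-cong : ∀ M {p q} → p ≗ q → ∀ t → Similar (run M p t) (run M q t)
  run-cong M e zero      = similar (const e)
  run-cong M e (ℕ.suc t) = step-cong (run-cong M e t)

  output-cong : ∀ M {p q} → p ≗ q → ∀ t → output M p t ≡ output M q t
  output-cong M {p} {q} e t with run M p t | run M q t | run-cong M e t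
  ... | _ | _ | similar _ = refl

  applyUpTo-cong : ∀ {r s : Baire} → r ≗ s → ∀ n → applyUpTo r n ≡ applyUpTo s n
  applyUpTo-cong e zero      = refl
  applyUpTo-cong e (ℕ.suc n) = cong₂ _∷_ (e 0) (applyUpTo-cong (e ∘ ℕ.suc) n)

  execute-extends : ∀ M I C → ∃[ xs ]
    Configuration.written (execute M I C) ≡ Configuration.written C ++ xs
  execute-extends M (readInput h k)    C = [] , sym (++-identityʳ _)
  execute-extends M (branchOn j k)     C = [] , sym (++-identityʳ _)
  execute-extends M (writeTape j s q)  C = [] , sym (++-identityʳ _)
  execute-extends M (moveTape j d q)   C = [] , sym (++-identityʳ _)
  execute-extends M (print stroke q)   C = [] , sym (++-identityʳ _)
  execute-extends M (print comma q)    C = Configuration.pending C ∷ [] , refl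

  output-extends : ∀ M p t d → ∃[ xs ] output M p (d + t) ≡ output M p t ++ xs
  output-extends M p t zero      = [] , sym (++-identityʳ _)
  output-extends M p t (ℕ.suc d)
    with output-extends M p t d
       | execute-extends M (Machine.program M (Configuration.state (run M p (d + t))))
                         (run M p (d + t))
  ... | xs , e | ys , f =
    xs ++ ys , trans f (trans (cong (_++ ys) e) (++-assoc (output M p t) xs ys))

  length-≡⇒≡ : ∀ (xs : List ℕ) {ys} → length (xs ++ ys) ≡ length xs → xs ++ ys ≡ xs
  length-≡⇒≡ xs {[]}     e = ++-identityʳ xs
  length-≡⇒≡ xs {y ∷ ys} e =
    ⊥-elim (m+1+n≢m (length xs) (trans (sym (length-++ xs)) e))

  output-unique : ∀ M p t t′ → t ≤ t′ →
    length (output M p t) ≡ length (output M p t′) → output M p t ≡ output M p t′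
  output-unique M p t t′ t≤t′ e
    with output-extends M p t (t′ ∸ t)
  ... | xs , f rewrite m∸n+n≡m t≤t′ =
    sym (trans f (length-≡⇒≡ (output M p t) (trans (cong length (sym f)) (sym e))))

↦-cong : ∀ M {p p′ r r′} → p ≗ p′ → r ≗ r′ → M ⊢ p ↦ r → M ⊢ p′ ↦ r′
↦-cong M p≗p′ r≗r′ d n with d n
... | t , e = t , trans (sym (output-cong M p≗p′ t)) (trans e (applyUpTo-cong r≗r′ n))

↦-functional : ∀ M {p r r′} → M ⊢ p ↦ r → M ⊢ p ↦ r′ → r ≗ r′
↦-functional M {p} {r} {r′} d d′ n with d (ℕ.suc n) | d′ (ℕ.suc n)
... | t , e | t′ , e′ = ∷ʳ-injectiveʳ (applyUpTo r n) (applyUpTo r′ n)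
  (trans (applyUpTo-∷ʳ r n) (trans same (sym (applyUpTo-∷ʳ r′ n))))
  where
  lengths : length (output M p t) ≡ length (output M p t′)
  lengths = trans (cong length e) (trans (length-applyUpTo r (ℕ.suc n))
    (sym (trans (cong length e′) (length-applyUpTo r′ (ℕ.suc n)))))

  outputs : output M p t ≡ output M p t′
  outputs with ≤-total t t′
  ... | inj₁ t≤t′ = output-unique M p t t′ t≤t′ lengths
  ... | inj₂ t′≤t = sym (output-unique M p t′ t t′≤t (sym lengths))

  same : applyUpTo r (ℕ.suc n) ≡ applyUpTo r′ (ℕ.suc n)
  same = trans (sym e) (trans outputs e′)

-- The representation is given by its graph: δ p x means that p is in the
-- domain of the representation and is mapped to x.
record RepresentedSpace a b c : Set (suc (a ⊔ b ⊔ c)) where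
  field
    setoid : Setoid a b
  open Setoid setoid public
  field
    δ            : Baire → Carrier → Set c
    δ-cong       : ∀ {p q x y} → p ≗ q → x ≈ y → δ p x → δ q y
    δ-functional : ∀ {p x y} → δ p x → δ p y → x ≈ y
    δ-surjective : ∀ x → ∃[ p ] δ p x

∣_∣ : RepresentedSpace a b c → Set a
∣ X ∣ = RepresentedSpace.Carrier X

infixr 4 _×ʳ_
_×ʳ_ : RepresentedSpace a₁ a₂ a₃ → RepresentedSpace b₁ b₂ b₃ →
       RepresentedSpace (a₁ ⊔ b₁) (a₂ ⊔ b₂) (a₃ ⊔ b₃)
X ×ʳ Y = record
  { setoid       = ×-setoid X.setoid Y.setoid
  ; δ            = λ s (x , y) → ∃[ p ] ∃[ q ] s ≗ ⟨ p , q ⟩ × X.δ p x × Y.δ q y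
  ; δ-cong       = λ s≗s′ (x≈x′ , y≈y′) (p , q , e , d , d′) →
      p , q , (λ n → trans (sym (s≗s′ n)) (e n)) ,
      X.δ-cong (λ _ → refl) x≈x′ d , Y.δ-cong (λ _ → refl) y≈y′ d′
  ; δ-functional = λ (p , q , e , d , d′) (p₁ , q₁ , e₁ , d₁ , d₁′) →
      let pairs : ⟨ p , q ⟩ ≗ ⟨ p₁ , q₁ ⟩
          pairs n = trans (sym (e n)) (e₁ n)
      in X.δ-functional (X.δ-cong (⟨,⟩-injectiveˡ pairs) X.refl d) d₁ ,
         Y.δ-functional (Y.δ-cong (⟨,⟩-injectiveʳ {p} {p₁} pairs) Y.refl d′) d₁′
  ; δ-surjective = λ (x , y) →
      let (p , d) = X.δ-surjective x ; (q , d′) = Y.δ-surjective y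
      in ⟨ p , q ⟩ , p , q , (λ _ → refl) , d , d′
  }
  where
  module X = RepresentedSpace X
  module Y = RepresentedSpace Y

-- The machine T computes exactly the partial function T of the definition,
-- including its domain dom(δ) × ℕ^ℕ.
EffectivelyTraceable : RepresentedSpace a b c → Set (a ⊔ c)
EffectivelyTraceable Y = Σ[ T ∈ Machine ]
  (∀ p q → (∃[ r ] T ⊢ ⟨ p , q ⟩ ↦ r) ⇔ (∃[ y ] δ p y)) ×
  (∀ p y → δ p y → ∀ r → (∃[ q ] T ⊢ ⟨ p , q ⟩ ↦ r) ⇔ δ r y)
  where open RepresentedSpace Y

-- A partial multi-valued function is given by its graph; its domain
-- consists of the points at which the set of values is nonempty.
record MultiFunction (X : RepresentedSpace a₁ a₂ a₃) (Y : RepresentedSpace b₁ b₂ b₃)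
                     v : Set (a₁ ⊔ a₂ ⊔ b₁ ⊔ b₂ ⊔ suc v) where
  private
    module X = RepresentedSpace X
    module Y = RepresentedSpace Y
  field
    value      : X.Carrier → Y.Carrier → Set v
    value-cong : ∀ {x x′ y y′} → x X.≈ x′ → y Y.≈ y′ → value x y → value x′ y′

  dom : X.Carrier → Set (b₁ ⊔ v)
  dom x = ∃[ y ] value x y

open MultiFunction public using (value; value-cong; dom)

infix 4 _≐_
_≐_ : {X : RepresentedSpace a₁ a₂ a₃} {Y : RepresentedSpace b₁ b₂ b₃} →
      MultiFunction X Y v → MultiFunction X Y w → Set (a₁ ⊔ b₁ ⊔ v ⊔ w)
f ≐ g = ∀ x y → value f x y ⇔ value g x y

infixr 9 _⊙_
_⊙_ : {X : RepresentedSpace a₁ a₂ a₃} {Y : RepresentedSpace b₁ b₂ b₃}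
      {Z : RepresentedSpace c₁ c₂ c₃} →
      MultiFunction Y Z v → MultiFunction X Y w → MultiFunction X Z (b₁ ⊔ c₁ ⊔ v ⊔ w)
_⊙_ {X = X} {Y} {Z} f g = record
  { value = λ x z →
      dom g x × (∀ y → value g x y → dom f y) × (∃[ y ] value g x y × value f y z)
  ; value-cong = λ x≈x′ z≈z′ ((y₀ , d) , i , (y , e , e′)) →
      (y₀ , value-cong g x≈x′ Y.refl d) ,
      (λ y₁ d₁ → i y₁ (value-cong g (X.sym x≈x′) Y.refl d₁)) ,
      (y , value-cong g x≈x′ Y.refl e , value-cong f Y.refl z≈z′ e′)
  }
  where
  module X = RepresentedSpace X
  module Y = RepresentedSpace Y

section : (Y : RepresentedSpace b₁ b₂ b₃) (X : RepresentedSpace a₁ a₂ a₃)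
          {Z : RepresentedSpace c₁ c₂ c₃} →
          MultiFunction (Y ×ʳ X) Z v → ∣ Y ∣ → MultiFunction X Z v
section Y X f y = record
  { value      = λ x z → value f (y , x) z
  ; value-cong = λ x≈x′ → value-cong f (RepresentedSpace.refl Y , x≈x′)
  }

infix 3 _⟶_
_⟶_ : RepresentedSpace a₁ a₂ a₃ → RepresentedSpace b₁ b₂ b₃ → Set (a₁ ⊔ a₂ ⊔ b₁ ⊔ b₂)
X ⟶ Y = Func (RepresentedSpace.setoid X) (RepresentedSpace.setoid Y)

graph : (X : RepresentedSpace a₁ a₂ a₃) (Y : RepresentedSpace b₁ b₂ b₃) →
        (X ⟶ Y) → MultiFunction X Y b₂
graph X Y f = record
  { value      = λ x y → f ⟨$⟩ x Y.≈ y
  ; value-cong = λ x≈x′ y≈y′ e → Y.trans (Y.sym (Func.cong f x≈x′)) (Y.trans e y≈y′)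
  }
  where module Y = RepresentedSpace Y

-- F is the graph of a partial function on Baire space.
Realizes : {X : RepresentedSpace a₁ a₂ a₃} {Y : RepresentedSpace b₁ b₂ b₃} →
           (F : Baire → Baire → Set) → MultiFunction X Y v → Set (a₁ ⊔ a₃ ⊔ b₁ ⊔ b₃ ⊔ v)
Realizes {X = X} {Y} F f = ∀ p x → X.δ p x → dom f x →
  ∃[ r ] F p r × (∃[ y ] Y.δ r y × value f x y)
  where
  module X = RepresentedSpace X
  module Y = RepresentedSpace Y

Computable : {X : RepresentedSpace a₁ a₂ a₃} {Y : RepresentedSpace b₁ b₂ b₃} →
             MultiFunction X Y v → Set (a₁ ⊔ a₃ ⊔ b₁ ⊔ b₃ ⊔ v)
Computable f = Σ[ M ∈ Machine ] Realizes (M ⊢_↦_) f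

module FunctionSpaces (U : Machine) where

  Φ : Baire → Baire → Baire → Set
  Φ p q r = U ⊢ ⟨ p , q ⟩ ↦ r

  module _ (X : RepresentedSpace a₁ a₂ a₃) (Y : RepresentedSpace b₁ b₂ b₃) where
    private
      module X = RepresentedSpace X
      module Y = RepresentedSpace Y

    Φ[_] : Baire → MultiFunction X Y (a₃ ⊔ b₁ ⊔ b₃)
    Φ[ e ] = record
      { value = λ x y →
          (∀ p q → X.δ p x → ∃[ r ] Φ e ⟨ p , q ⟩ r × (∃[ y′ ] Y.δ r y′)) ×
          (∃[ p ] ∃[ q ] ∃[ r ] X.δ p x × Φ e ⟨ p , q ⟩ r × Y.δ r y)
      ; value-cong = λ x≈x′ y≈y′ (d , p , q , r , h , φ , k) →
          (λ p′ q′ h′ → d p′ q′ (X.δ-cong (λ _ → refl) (X.sym x≈x′) h′)) ,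
          p , q , r , X.δ-cong (λ _ → refl) x≈x′ h , φ , Y.δ-cong (λ _ → refl) y≈y′ k
      }

    Φ-cong : ∀ {e e′ q r} → e ≗ e′ → Φ e q r → Φ e′ q r
    Φ-cong {q = q} e≗e′ = ↦-cong U (⟨,⟩-cong {q = q} e≗e′ (λ _ → refl)) (λ _ → refl)

    Φ[]-mono : ∀ {e e′} → e ≗ e′ → ∀ x y → value Φ[ e ] x y → value Φ[ e′ ] x y
    Φ[]-mono e≗e′ x y (d , p , q , r , h , φ , k) =
      (λ p′ q′ h′ → let (r′ , φ′ , k′) = d p′ q′ h′ in r′ , Φ-cong e≗e′ φ′ , k′) ,
      p , q , r , h , Φ-cong e≗e′ φ , k

    StronglyContinuous : Set (a₁ ⊔ a₂ ⊔ b₁ ⊔ b₂ ⊔ suc (a₃ ⊔ b₁ ⊔ b₃))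
    StronglyContinuous = Σ[ f ∈ MultiFunction X Y (a₃ ⊔ b₁ ⊔ b₃) ] ∃[ p ] f ≐ Φ[ p ]

    𝓜 : RepresentedSpace (a₁ ⊔ a₂ ⊔ b₁ ⊔ b₂ ⊔ suc (a₃ ⊔ b₁ ⊔ b₃))
                         (a₁ ⊔ a₃ ⊔ b₁ ⊔ b₃) (a₁ ⊔ a₃ ⊔ b₁ ⊔ b₃)
    𝓜 = record
      { setoid = record
          { Carrier       = StronglyContinuous
          ; _≈_           = λ (f , _) (g , _) → f ≐ g
          ; isEquivalence = record
              { refl  = λ x y → E.refl
              ; sym   = λ f≐g x y → E.sym (f≐g x y)
              ; trans = λ f≐g g≐h x y → E.trans (f≐g x y) (g≐h x y)
              }
          }
      ; δ            = λ p (f , _) → f ≐ Φ[ p ]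
      ; δ-cong       = λ p≗q f≐g d x y → E.trans (E.sym (f≐g x y)) (E.trans (d x y)
          (mk⇔ (Φ[]-mono p≗q x y) (Φ[]-mono (λ n → sym (p≗q n)) x y)))
      ; δ-functional = λ d d′ x y → E.trans (d x y) (E.sym (d′ x y))
      ; δ-surjective = proj₂
      }
      where
      module E {ℓ} = IsEquivalence (⇔-isEquivalence {ℓ})

    -- The partial functions Φ p are, up to extension, all the continuous
    -- ones, so continuity amounts to being realized by some Φ p.
    Continuous : Set (a₁ ⊔ a₂ ⊔ a₃ ⊔ b₁ ⊔ b₂ ⊔ b₃)
    Continuous = Σ[ f ∈ (X ⟶ Y) ] ∃[ p ] Realizes (Φ p) (graph X Y f)

    𝓒 : RepresentedSpace (a₁ ⊔ a₂ ⊔ a₃ ⊔ b₁ ⊔ b₂ ⊔ b₃) (a₁ ⊔ b₂) (a₁ ⊔ a₃ ⊔ b₁ ⊔ b₂ ⊔ b₃)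
    𝓒 = record
      { setoid       = On.setoid (FuncEquality.setoid X.setoid Y.setoid) proj₁
      ; δ            = λ p (f , _) → Realizes (Φ p) (graph X Y f)
      ; δ-cong       = λ p≗q f≈g d u x h _ →
          let (r , φ , y , k , e) = d u x h (_ , Y.refl)
          in r , Φ-cong p≗q φ , y , k , Y.trans (Y.sym (f≈g x)) e
      ; δ-functional = λ d d′ x →
          let (u , h)                 = X.δ-surjective x
              (r , φ , y , k , e)     = d u x h (_ , Y.refl)
              (r′ , φ′ , y′ , k′ , e′) = d′ u x h (_ , Y.refl)
              y≈y′ = Y.δ-functional (Y.δ-cong (↦-functional U φ φ′) Y.refl k) k′
          in Y.trans e (Y.trans y≈y′ (Y.sym e′))
      ; δ-surjective = proj₂
      }

{-# OPTIONS --safe #-}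
module Submission where

-- Let e and e′ be names of f and g. On ⟨ p , ⟨ q₁ , ⟨ q₂ , q₃ ⟩ ⟩ ⟩, where p names a
-- point x and the rest is the free parameter of a multi-valued function, a name
-- of f ⊙ g computes
--   t = Φ e′ ⟨ p , q₁ ⟩ ,   u = T ⟨ t , q₂ ⟩ ,   r = Φ e ⟨ u , q₃ ⟩
-- where T traces Y. As p and q₁ vary, t runs through names of all the values y
-- of g at x, but perhaps not through all names of y; as q₂ varies, u runs through
-- all of them. Hence the values r names are exactly those of f at the values of
-- g, and r exists for all parameters only if f is defined at every value of g.
-- For currying, a name u of y is likewise replaced by all names T ⟨ u , q₁ ⟩ of y
-- before it is paired with a name of x; the section of f at y is then the
-- function named by this machine with the parameters e and u fixed. These are
-- composer-names and currier-names.
--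
-- Universality of U turns a machine with a parameter into a map from parameters
-- to names that is itself computed by a machine. For composition this is used
-- once. For currying it is used a second time, for the machine that computes the
-- name of the section from e and u: it yields a name, computable from e, of the
-- map from u to the name of the section.
--
-- What remains is to build machines for the two chains of computations. They are
-- assembled from projections, pairing and composition of machines, and the
-- domains have to be exact: the whole may write infinitely many numbers only if
-- every intermediate computation does. A composite of M and N need not store the
-- output of N. It runs one copy of N for every head of M and lets the copy take
-- steps whenever that head waits for a glyph; one further copy has to complete a
-- block before each block completed by M, so that the composite diverges if N
-- does (composite-spec). Pairing copies the outputs of two machines block by block
-- in turn (pair-spec). In both cases a finite control directs a bank of machines
-- that run on the same input. That a copy is in step with the sequence it prints
-- is expressed by rest, the sequence that a machine has still to print at a given
-- time; waiting for the next comma of a copy is comma-induction.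

open import Defs
open import Level using (Level; _⊔_)
open import Data.Empty using (⊥-elim)
open import Data.Fin.Base using (Fin; zero; suc; toℕ; combine; remQuot; splitAt; _↑ˡ_; _↑ʳ_)
open import Data.Fin.Properties
  using (_≟_; suc-injective; remQuot-combine; ↑ˡ-injective; ↑ʳ-injective; splitAt-↑ˡ; splitAt-↑ʳ)
open import Data.List.Base using (List; []; _∷_; _++_; _∷ʳ_; length; applyUpTo)
open import Data.List.Properties
  using (++-assoc; ++-identityʳ; length-++-≤ˡ; length-++-sucʳ; length-applyUpTo)
open import Data.Maybe.Base using (Maybe; just; nothing)
open import Data.Nat.Base using (ℕ; zero; suc; _+_; _*_; _∸_; _≤_; _<_; z≤n; s≤s)
open import Data.Nat.Properties
  using ( ≤-refl; ≤-trans; ≤-reflexive; ≤-pred; ≤-total; <-irrefl; <⇒≤; <⇒≱; ≮⇒≥; n≤1+n; n≤0⇒n≡0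
        ; m≤n⇒m<n∨m≡n; m∸n+n≡m; +-suc; +-identityʳ; +-cancelˡ-≡; +-mono-≤; module ≤-Reasoning)
open import Data.Product using (Σ-syntax; ∃-syntax; _×_; _,_; proj₁; proj₂)
open import Data.Sum.Base using (inj₁; inj₂)
open import Data.Vec.Functional using (Vector; updateAt; foldr)
open import Data.Vec.Functional.Properties using (updateAt-updates; updateAt-minimal)
open import Function.Base using (_∘_; const)
open import Function.Bundles using (_⇔_; mk⇔; Equivalence; _⟨$⟩_)
open import Relation.Binary.PropositionalEquality
open import Relation.Nullary using (Dec; yes; no)

open Machine
open Configuration
open Equivalence using (to; from)

private
  variable
    a₁ a₂ a₃ b₁ b₂ b₃ c₁ c₂ c₃ ℓ₁ ℓ₂ ℓ₃ ℓ₄ : Level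
    M : Machine
    p r : Baire

-- Lists of natural numbers as prefixes of sequences

nth : List ℕ → Baire
nth []       _       = 0
nth (x ∷ xs) zero    = x
nth (x ∷ xs) (suc i) = nth xs i

nth-++ : ∀ xs ys {i} → i < length xs → nth (xs ++ ys) i ≡ nth xs i
nth-++ (x ∷ xs) ys {zero}  _         = refl
nth-++ (x ∷ xs) ys {suc i} (s≤s i<n) = nth-++ xs ys i<n

nth-applyUpTo : ∀ r {n i} → i < n → nth (applyUpTo r n) i ≡ r i
nth-applyUpTo r {suc n} {zero}  _         = refl
nth-applyUpTo r {suc n} {suc i} (s≤s i<n) = nth-applyUpTo (r ∘ suc) i<n

nth⇒applyUpTo : ∀ xs r → (∀ {i} → i < length xs → nth xs i ≡ r i) →
                xs ≡ applyUpTo r (length xs)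
nth⇒applyUpTo []       r e = refl
nth⇒applyUpTo (x ∷ xs) r e = cong₂ _∷_ (e (s≤s z≤n)) (nth⇒applyUpTo xs (r ∘ suc) (e ∘ s≤s))

-- The sequence that begins with a given list.
infixr 5 _⌢_
_⌢_ : List ℕ → Baire → Baire
[]       ⌢ b = b
(x ∷ xs) ⌢ b = x ◂ (xs ⌢ b)

◂-cong : ∀ n {b c} → b ≗ c → n ◂ b ≗ n ◂ c
◂-cong n e zero    = refl
◂-cong n e (suc i) = e i

⌢-cong : ∀ xs {b c} → b ≗ c → xs ⌢ b ≗ xs ⌢ c
⌢-cong []       e = e
⌢-cong (x ∷ xs) e = ◂-cong x (⌢-cong xs e)

⌢-cancel : ∀ xs {b c} → xs ⌢ b ≗ xs ⌢ c → b ≗ c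
⌢-cancel []       e = e
⌢-cancel (x ∷ xs) e = ⌢-cancel xs (e ∘ suc)

⌢-∷ʳ : ∀ xs n b → (xs ∷ʳ n) ⌢ b ≗ xs ⌢ n ◂ b
⌢-∷ʳ []       n b = λ _ → refl
⌢-∷ʳ (x ∷ xs) n b = ◂-cong x (⌢-∷ʳ xs n b)

⌢⇒applyUpTo : ∀ xs {b r} → xs ⌢ b ≗ r → xs ≡ applyUpTo r (length xs)
⌢⇒applyUpTo []       e = refl
⌢⇒applyUpTo (x ∷ xs) e = cong₂ _∷_ (e 0) (⌢⇒applyUpTo xs (e ∘ suc))

applyUpTo-⌢ : ∀ r n → applyUpTo r n ⌢ (λ i → r (n + i)) ≗ r
applyUpTo-⌢ r zero    i       = refl
applyUpTo-⌢ r (suc n) zero    = refl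
applyUpTo-⌢ r (suc n) (suc i) = applyUpTo-⌢ (r ∘ suc) n i

-- The glyphs printed by a machine

-- The glyph that an instruction prints, if any.
emission : ∀ {s h t} → Instruction s h t → Maybe Glyph
emission (print g _) = just g
emission _           = nothing

module _ (M : Machine) where

  instruction : Configuration M → Instruction (states M) (heads M) (tapes M)
  instruction C = program M (state C)

  emissionAt : Baire → ℕ → Maybe Glyph
  emissionAt p t = emission (instruction (run M p t))

-- The contents of the output tape: the completed blocks and the number of
-- strokes pending after the last comma.
Tally : Set
Tally = List ℕ × ℕ

tally : Configuration M → Tally
tally C = written C , pending C

-- The effect of an emission on the output tape.
emit : Maybe Glyph → Tally → Tally
emit nothing       T       = T
emit (just stroke) (w , n) = w , suc n
emit (just comma)  (w , n) = w ∷ʳ n , 0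

execute-tally : ∀ M I C → tally (execute M I C) ≡ emit (emission I) (tally C)
execute-tally M (readInput _ _)   C = refl
execute-tally M (branchOn _ _)    C = refl
execute-tally M (writeTape _ _ _) C = refl
execute-tally M (moveTape _ _ _)  C = refl
execute-tally M (print stroke _)  C = refl
execute-tally M (print comma _)   C = refl

run-tally : ∀ M p t → tally (run M p (suc t)) ≡ emit (emissionAt M p t) (tally (run M p t))
run-tally M p t = execute-tally M _ (run M p t)

-- The number of blocks completed by time t.
count : Machine → Baire → ℕ → ℕ
count M p t = length (output M p t)

-- The effect of an emission on the number of completed blocks.
commas : Maybe Glyph → ℕ → ℕ
commas (just comma) n = suc n
commas _            n = n

emit-count : ∀ e T → length (proj₁ (emit e T)) ≡ commas e (length (proj₁ T))
emit-count nothing       T       = refl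
emit-count (just stroke) T       = refl
emit-count (just comma)  (w , n) = trans (length-++-sucʳ w n []) (cong (suc ∘ length) (++-identityʳ w))

run-count : ∀ M p t → count M p (suc t) ≡ commas (emissionAt M p t) (count M p t)
run-count M p t = trans (cong (length ∘ proj₁) (run-tally M p t)) (emit-count (emissionAt M p t) _)

emit-extends : ∀ e T → ∃[ xs ] proj₁ (emit e T) ≡ proj₁ T ++ xs
emit-extends nothing       T = [] , sym (++-identityʳ _)
emit-extends (just stroke) T = [] , sym (++-identityʳ _)
emit-extends (just comma)  T = proj₂ T ∷ [] , refl

output-extends : ∀ M p {t t′} → t ≤ t′ → ∃[ xs ] output M p t′ ≡ output M p t ++ xs
output-extends M p {t} {t′} t≤t′ =
  subst (λ u → ∃[ xs ] output M p u ≡ output M p t ++ xs) (m∸n+n≡m t≤t′) (go (t′ ∸ t))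
  where
  go : ∀ d → ∃[ xs ] output M p (d + t) ≡ output M p t ++ xs
  go zero    = [] , sym (++-identityʳ _)
  go (suc d) with go d | emit-extends (emissionAt M p (d + t)) (tally (run M p (d + t)))
  ... | xs , e | ys , f = xs ++ ys ,
    trans (cong proj₁ (run-tally M p (d + t)))
      (trans f (trans (cong (_++ ys) e) (++-assoc (output M p t) xs ys)))

count-mono : ∀ M p {t t′} → t ≤ t′ → count M p t ≤ count M p t′
count-mono M p {t} t≤t′ with output-extends M p t≤t′
... | xs , e = ≤-trans (length-++-≤ˡ (output M p t)) (≤-reflexive (cong length (sym e)))

nth-output : ∀ M p t t′ {i} → i < count M p t → i < count M p t′ →
             nth (output M p t) i ≡ nth (output M p t′) i
nth-output M p t t′ i<n i<n′ with ≤-total t t′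
... | inj₁ t≤t′ with output-extends M p t≤t′
...   | xs , e = sym (trans (cong (λ w → nth w _) e) (nth-++ (output M p t) xs i<n))
nth-output M p t t′ i<n i<n′ | inj₂ t′≤t with output-extends M p t′≤t
...   | xs , e = trans (cong (λ w → nth w _) e) (nth-++ (output M p t′) xs i<n′)

-- M writes infinitely many numbers on input p. Together with the next lemmas
-- this describes the domain of the partial function computed by M without
-- reference to its value.
Productive : Machine → Baire → Set
Productive M p = ∀ n → ∃[ t ] n ≤ count M p t

-- The number of completed blocks grows by at most one in each step, hence
-- takes every value.
productive⇒exact : Productive M p → ∀ n → ∃[ t ] count M p t ≡ n
productive⇒exact {M} {p} prod n = let (t , n≤) = prod n in go t n≤
  where
  commas-≤ : ∀ e m → commas e m ≤ suc m
  commas-≤ nothing       m = n≤1+n m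
  commas-≤ (just stroke) m = n≤1+n m
  commas-≤ (just comma)  m = ≤-refl

  go : ∀ t → n ≤ count M p t → ∃[ t ] count M p t ≡ n
  go zero    n≤ = 0 , sym (n≤0⇒n≡0 n≤)
  go (suc t) n≤ with m≤n⇒m<n∨m≡n n≤
  ... | inj₂ e = suc t , sym e
  ... | inj₁ n< = go t (≤-pred (≤-trans n<
    (≤-trans (≤-reflexive (run-count M p t)) (commas-≤ (emissionAt M p t) _))))

-- By the preceding lemma an infinite output that agrees with r is r.
prefixes⇒↦ : Productive M p → (∀ t → output M p t ≡ applyUpTo r (count M p t)) → M ⊢ p ↦ r
prefixes⇒↦ {r = r} prod e n with productive⇒exact prod n
... | t , refl = t , e t

-- The i-th term of the limit can be read off from any output of more than i
-- blocks, since outputs only grow.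
productive⇒↦ : Productive M p → ∃[ r ] M ⊢ p ↦ r
productive⇒↦ {M} {p} prod = limit , prefixes⇒↦ {M} prod λ t →
  nth⇒applyUpTo _ limit λ {i} i<n → nth-output M p t (proj₁ (prod (suc i))) i<n (proj₂ (prod (suc i)))
  where
  limit : Baire
  limit i = nth (output M p (proj₁ (prod (suc i)))) i

↦⇒productive : M ⊢ p ↦ r → Productive M p
↦⇒productive {r = r} d n with d n
... | t , e = t , ≤-reflexive (sym (trans (cong length e) (length-applyUpTo r n)))

↦⇒prefixes : M ⊢ p ↦ r → ∀ t → output M p t ≡ applyUpTo r (count M p t)
↦⇒prefixes {M} {p} {r} d t = nth⇒applyUpTo _ r λ {i} i<n →
  let (t′ , e) = d (suc i)
      i<n′ = ≤-reflexive (sym (trans (cong length e) (length-applyUpTo r (suc i))))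
  in trans (nth-output M p t t′ i<n i<n′) (trans (cong (λ w → nth w i) e) (nth-applyUpTo r ≤-refl))

commas-idle : ∀ {e} → e ≢ just comma → ∀ n → commas e n ≡ n
commas-idle {nothing}     _ n = refl
commas-idle {just stroke} _ n = refl
commas-idle {just comma}  c n = ⊥-elim (c refl)

comma? : (e : Maybe Glyph) → Dec (e ≡ just comma)
comma? nothing       = no λ ()
comma? (just stroke) = no λ ()
comma? (just comma)  = yes refl

-- Waiting for the next comma: while M is productive, a property of times that
-- holds when M prints a comma and is inherited from t + 1 to any other time t
-- holds at all times.
comma-induction : ∀ M p → Productive M p → (P : ℕ → Set) →
  (∀ t → emissionAt M p t ≡ just comma → P t) →
  (∀ t → emissionAt M p t ≢ just comma → P (suc t) → P t) →
  ∀ t → P t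
comma-induction M p prod P base back t =
  let (t′ , n<) = prod (suc (count M p t))
      t≤t′ : t ≤ t′
      t≤t′ = ≮⇒≥ λ t′<t → <⇒≱ n< (count-mono M p (<⇒≤ t′<t))
  in go (t′ ∸ t) t (subst (λ u → count M p t < count M p u) (sym (m∸n+n≡m t≤t′)) n<)
  where
  go : ∀ d t → count M p t < count M p (d + t) → P t
  go zero    t n< = ⊥-elim (<-irrefl refl n<)
  go (suc d) t n< with comma? (emissionAt M p t)
  ... | yes c = base t c
  ... | no ¬c = back t ¬c (go d (suc t)
    (subst₂ _<_ (sym (trans (run-count M p t) (commas-idle ¬c _)))
                (cong (count M p) (sym (+-suc d t))) n<))

-- What a machine has still to print

-- The sequence whose glyph expansion begins with the given emission, followed
-- by the expansion of b; next is inverse to it. A stroke extends the first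
-- block, a comma puts an empty block in front.
push : Maybe Glyph → Baire → Baire
push nothing       b = b
push (just stroke) b = suc (b 0) ◂ tail b
push (just comma)  b = 0 ◂ b

next-push : ∀ g {b c} → b ≗ push (just g) c → proj₁ (next b) ≡ g × proj₂ (next b) ≗ c
next-push stroke {b} e with b 0 | e 0
... | suc _ | refl = refl , λ { zero → refl ; (suc i) → e (suc i) }
next-push comma {b} e with b 0 | e 0
... | zero | _ = refl , λ i → e (suc i)

-- The sequence that results if b is printed after what is already on the
-- output tape: pending strokes belong to the first block of b.
complete : Tally → Baire → Baire
complete (w , n) b = w ⌢ (n + b 0) ◂ tail b

complete-cong : ∀ T {b c} → b ≗ c → complete T b ≗ complete T c
complete-cong (w , n) e = ⌢-cong w λ { zero → cong (n +_) (e 0) ; (suc i) → e (suc i) }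

complete-cancel : ∀ T {b c} → complete T b ≗ complete T c → b ≗ c
complete-cancel (w , n) e zero    = +-cancelˡ-≡ n _ _ (⌢-cancel w e 0)
complete-cancel (w , n) e (suc i) = ⌢-cancel w e (suc i)

complete-zero : ∀ w b → complete (w , 0) b ≗ w ⌢ b
complete-zero w b = ⌢-cong w λ { zero → refl ; (suc i) → refl }

complete-emit : ∀ e T b → complete (emit e T) b ≗ complete T (push e b)
complete-emit nothing       T       b i = refl
complete-emit (just stroke) (w , n) b   = ⌢-cong w λ { zero → sym (+-suc n (b 0)) ; (suc i) → refl }
complete-emit (just comma)  (w , n) b i =
  trans (complete-zero (w ∷ʳ n) b i) (trans (⌢-∷ʳ w n b i)
    (⌢-cong w (λ { zero → sym (+-identityʳ n) ; (suc i) → refl }) i))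

-- rest t is the sequence that M has still to print at time t. It exists because
-- it does so right after each comma, when no strokes are pending and what has been
-- written is a prefix of r, and can be carried back from there by push.
module _ {M : Machine} {p r : Baire} (d : M ⊢ p ↦ r) where

  -- The equations below determine rest; unfolding it would only expose the
  -- search for the next comma.
  abstract

    private
      unread : ∀ t → ∃[ b ] complete (tally (run M p t)) b ≗ r
      unread = comma-induction M p (↦⇒productive d) _
        (λ t c → back t (after-comma t c))
        (λ t _ → back t)
        where
        back : ∀ t → ∃[ b ] complete (tally (run M p (suc t))) b ≗ r →
               ∃[ b ] complete (tally (run M p t)) b ≗ r
        back t (b , e) = push (emissionAt M p t) b , λ i →
          trans (sym (complete-emit (emissionAt M p t) _ b i))
            (trans (cong (λ T → complete T b i) (sym (run-tally M p t))) (e i))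

        after-comma : ∀ t → emissionAt M p t ≡ just comma →
                      ∃[ b ] complete (tally (run M p (suc t))) b ≗ r
        after-comma t c = b , λ i → begin
          complete (tally (run M p (suc t))) b i  ≡⟨ cong (λ n → complete (w , n) b i) no-strokes ⟩
          complete (w , 0) b i                    ≡⟨ complete-zero w b i ⟩
          (w ⌢ b) i                               ≡⟨ cong (λ v → (v ⌢ b) i) (↦⇒prefixes d (suc t)) ⟩
          (applyUpTo r (length w) ⌢ b) i          ≡⟨ applyUpTo-⌢ r (length w) i ⟩
          r i                                     ∎
          where
          open ≡-Reasoning
          w : List ℕ
          w = output M p (suc t)
          b : Baire
          b i = r (length w + i)
          no-strokes : pending (run M p (suc t)) ≡ 0
          no-strokes = trans (cong proj₂ (run-tally M p t))
            (cong (λ e → proj₂ (emit e (tally (run M p t)))) c)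

    rest : ℕ → Baire
    rest t = proj₁ (unread t)

    rest-step : ∀ t → rest t ≗ push (emissionAt M p t) (rest (suc t))
    rest-step t = complete-cancel (tally (run M p t)) λ i →
      trans (proj₂ (unread t) i) (trans (sym (proj₂ (unread (suc t)) i))
        (trans (cong (λ T → complete T (rest (suc t)) i) (run-tally M p t))
          (complete-emit (emissionAt M p t) _ _ i)))

    rest-start : rest 0 ≗ r
    rest-start i = trans (sym (complete-zero [] rest₀ i)) (proj₂ (unread 0) i)
      where
      rest₀ : Baire
      rest₀ = rest 0

-- Conversely, a productive machine computes b 0 if b t always consists of what
-- is printed in step t, followed by b (t + 1).
unfold⇒↦ : ∀ M {p r} (b : ℕ → Baire) → b 0 ≗ r →
  (∀ t → b t ≗ push (emissionAt M p t) (b (suc t))) → Productive M p → M ⊢ p ↦ r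
unfold⇒↦ M {p} {r} b start step prod =
  prefixes⇒↦ {M} prod λ t → ⌢⇒applyUpTo (output M p t) (completes t)
  where
  completes : ∀ t → complete (tally (run M p t)) (b t) ≗ r
  completes zero    i = trans (complete-zero [] (b 0) i) (start i)
  completes (suc t) i =
    trans (cong (λ T → complete T (b (suc t)) i) (run-tally M p t))
      (trans (complete-emit (emissionAt M p t) _ _ i)
        (trans (complete-cong (tally (run M p t)) (λ j → sym (step t j)) i) (completes t i)))

-- Finite sums and products of finite sets

-- Fin (∑ n) is the disjoint union of the sets Fin (n i), with injections inject n i,
-- and Fin (∏ n) is their product.

∑ ∏ : ∀ {k} → Vector ℕ k → ℕ
∑ = foldr _+_ 0
∏ = foldr _*_ 1

inject : ∀ {k} (n : Vector ℕ k) i → Fin (n i) → Fin (∑ n)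
inject n zero    x = x ↑ˡ _
inject n (suc i) x = n zero ↑ʳ inject (n ∘ suc) i x

↑ˡ≢↑ʳ : ∀ {m n} (x : Fin m) (y : Fin n) → x ↑ˡ n ≢ m ↑ʳ y
↑ˡ≢↑ʳ {m} {n} x y e with trans (sym (splitAt-↑ˡ m x n)) (trans (cong (splitAt m) e) (splitAt-↑ʳ m n y))
... | ()

inject-injective : ∀ {k} (n : Vector ℕ k) i {x y} → inject n i x ≡ inject n i y → x ≡ y
inject-injective n zero    e = ↑ˡ-injective _ _ _ e
inject-injective n (suc i) e = inject-injective (n ∘ suc) i (↑ʳ-injective (n zero) _ _ e)

inject-disjoint : ∀ {k} (n : Vector ℕ k) {i j} → i ≢ j → ∀ x y → inject n i x ≢ inject n j y
inject-disjoint n {zero}  {zero}  i≢j x y e = i≢j refl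
inject-disjoint n {zero}  {suc j} i≢j x y e = ↑ˡ≢↑ʳ x _ e
inject-disjoint n {suc i} {zero}  i≢j x y e = ↑ˡ≢↑ʳ y _ (sym e)
inject-disjoint n {suc i} {suc j} i≢j x y e =
  inject-disjoint (n ∘ suc) (i≢j ∘ cong suc) x y (↑ʳ-injective (n zero) _ _ e)

encode : ∀ {k} (n : Vector ℕ k) → (∀ i → Fin (n i)) → Fin (∏ n)
encode {zero}  n f = zero
encode {suc k} n f = combine (f zero) (encode (n ∘ suc) (λ i → f (suc i)))

decode : ∀ {k} (n : Vector ℕ k) → Fin (∏ n) → ∀ i → Fin (n i)
decode n x zero    = proj₁ (remQuot (∏ (n ∘ suc)) x)
decode n x (suc i) = decode (n ∘ suc) (proj₂ (remQuot {n zero} (∏ (n ∘ suc)) x)) i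

decode-encode : ∀ {k} (n : Vector ℕ k) f i → decode n (encode n f) i ≡ f i
decode-encode n f zero    = cong proj₁ (remQuot-combine (f zero) _)
decode-encode n f (suc i) =
  trans (cong (λ x → decode (n ∘ suc) (proj₂ x) i) (remQuot-combine (f zero) _))
        (decode-encode (n ∘ suc) (λ i → f (suc i)) i)

-- Updating one component of a family

-- The dependent counterpart of updateAt.
set : ∀ {k} {A : Fin k → Set} → (∀ i → A i) → ∀ i → A i → ∀ j → A j
set f zero    x zero    = x
set f zero    x (suc j) = f (suc j)
set f (suc i) x zero    = f zero
set f (suc i) x (suc j) = set (λ i → f (suc i)) i x j

set-same : ∀ {k} {A : Fin k → Set} (f : ∀ i → A i) i x → set f i x i ≡ x
set-same f zero    x = refl
set-same f (suc i) x = set-same (λ i → f (suc i)) i x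

set-other : ∀ {k} {A : Fin k → Set} (f : ∀ i → A i) i x {j} → j ≢ i → set f i x j ≡ f j
set-other f zero    x {zero}  j≢i = ⊥-elim (j≢i refl)
set-other f zero    x {suc j} j≢i = refl
set-other f (suc i) x {zero}  j≢i = refl
set-other f (suc i) x {suc j} j≢i = set-other (λ i → f (suc i)) i x (j≢i ∘ cong suc)

-- Updating commutes with restriction along an injection.
updateAt-along : ∀ {A : Set} {m n} (ι : Fin m → Fin n) → (∀ {i j} → ι i ≡ ι j → i ≡ j) →
  {xs : Vector A n} {ys : Vector A m} → (∀ i → xs (ι i) ≡ ys i) →
  ∀ i f j → updateAt xs (ι i) f (ι j) ≡ updateAt ys i f j
updateAt-along ι inj {xs} {ys} e i f j with j ≟ i
... | yes refl = trans (updateAt-updates (ι i) xs) (trans (cong f (e i)) (sym (updateAt-updates i ys)))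
... | no j≢i   = trans (updateAt-minimal (ι j) (ι i) xs (j≢i ∘ inj)) (trans (e j) (sym (updateAt-minimal j i ys j≢i)))

-- Clocks of a family of machines that take steps one at a time.
tick : ∀ {k} → Fin k → (Fin k → ℕ) → Fin k → ℕ
tick i τ = updateAt τ i suc

ticked : ∀ {k} (P : Fin k → ℕ → Set) {τ i} → P i (suc (τ i)) → (∀ j → j ≢ i → P j (τ j)) →
         ∀ j → P j (tick i τ j)
ticked P {τ} {i} here there j with j ≟ i
... | yes refl = subst (P i) (sym (updateAt-updates i τ)) here
... | no j≢i   = subst (P j) (sym (updateAt-minimal j i τ j≢i)) (there j j≢i)

-- Banks of machines

-- Ingredients of a machine that simulates the machines N i, all on its own
-- input, under the direction of a finite control with c states; it has t₀
-- work tapes of its own besides those of the N i. Its states consist of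
-- a control state and a state of each N i.
module Bank {k : ℕ} (N : Fin k → Machine) (c t₀ : ℕ) where

  Copies : Set
  Copies = ∀ i → Fin (states (N i))

  S H T : ℕ
  S = c * ∏ (states ∘ N)
  H = ∑ (heads ∘ N)
  T = t₀ + ∑ (tapes ∘ N)

  code : Fin c → Copies → Fin S
  code q f = combine q (encode (states ∘ N) f)

  controlOf : Fin S → Fin c
  controlOf x = proj₁ (remQuot (∏ (states ∘ N)) x)

  copiesOf : Fin S → Copies
  copiesOf x = decode (states ∘ N) (proj₂ (remQuot {c} (∏ (states ∘ N)) x))

  controlOf-code : ∀ q f → controlOf (code q f) ≡ q
  controlOf-code q f = cong proj₁ (remQuot-combine q _)

  copiesOf-code : ∀ q f i → copiesOf (code q f) i ≡ f i
  copiesOf-code q f i = trans (cong (λ x → decode (states ∘ N) (proj₂ x) i) (remQuot-combine q _))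
    (decode-encode (states ∘ N) f i)

  own : Fin t₀ → Fin T
  own j = j ↑ˡ _

  head : ∀ i → Fin (heads (N i)) → Fin H
  head = inject (heads ∘ N)

  work : ∀ i → Fin (tapes (N i)) → Fin T
  work i j = t₀ ↑ʳ inject (tapes ∘ N) i j

  work-injective : ∀ i {x y} → work i x ≡ work i y → x ≡ y
  work-injective i e = inject-injective (tapes ∘ N) i (↑ʳ-injective t₀ _ _ e)

  work-disjoint : ∀ {i j} → i ≢ j → ∀ x y → work i x ≢ work j y
  work-disjoint i≢j x y e = inject-disjoint (tapes ∘ N) i≢j x y (↑ʳ-injective t₀ _ _ e)

  -- An instruction of N i as an instruction of the bank. Nothing is printed:
  -- onPrint says what happens instead to a glyph printed by N i.
  perform : ∀ i → Instruction (states (N i)) (heads (N i)) (tapes (N i)) →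
            (Fin (states (N i)) → Fin S) → (Glyph → Fin (states (N i)) → Instruction S H T) →
            Instruction S H T
  perform i (readInput h k)   σ onPrint = readInput (head i h) (σ ∘ k)
  perform i (branchOn j k)    σ onPrint = branchOn (work i j) (σ ∘ k)
  perform i (writeTape j s x) σ onPrint = writeTape (work i j) s (σ x)
  perform i (moveTape j d x)  σ onPrint = moveTape (work i j) d (σ x)
  perform i (print g x)       σ onPrint = onPrint g x

  -- The next step of N i, when the control state is q and the states of the
  -- machines are f; unless a glyph is printed, the control state stays the same.
  drive : ∀ i → Fin c → Copies → (Glyph → Fin (states (N i)) → Instruction S H T) → Instruction S H T
  drive i q f = perform i (program (N i) (f i)) (λ x → code q (set f i x))

  perform-emission : ∀ i I {σ onPrint} → emission I ≡ nothing → emission (perform i I σ onPrint) ≡ nothing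
  perform-emission i (readInput _ _)   e = refl
  perform-emission i (branchOn _ _)    e = refl
  perform-emission i (writeTape _ _ _) e = refl
  perform-emission i (moveTape _ _ _)  e = refl

  module Controlled (start₀ : Fin c) (control : Fin c → Copies → Instruction S H T) where

    K : Machine
    K = record
      { states  = S
      ; heads   = H
      ; tapes   = T
      ; start   = code start₀ (λ i → start (N i))
      ; program = λ x → control (controlOf x) (copiesOf x)
      }

    -- The heads and tapes of C reserved for N i look like those of D.
    record Wired i (C : Configuration K) (D : Configuration (N i)) : Set where
      constructor wired
      field
        inputs≡ : ∀ h → inputs C (head i h) ≡ inputs D h
        works≡  : ∀ j → works C (work i j) ≡ works D j
    open Wired

    Undisturbed : ∀ j → Configuration K → Configuration K → Set
    Undisturbed j C C′ = ∀ {D} → Wired j C D → Wired j C′ D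

    perform-silent : ∀ i I σ onPrint {C D} → emission I ≡ nothing → Wired i C D →
      let C′ = execute K (perform i I σ onPrint) C
          D′ = execute (N i) I D
      in state C′ ≡ σ (state D′) × tally C′ ≡ tally C × Wired i C′ D′ ×
         (∀ j → works C′ (own j) ≡ works C (own j)) ×
         (∀ j → j ≢ i → Undisturbed j C C′)
    perform-silent i (readInput h k) σ onPrint {C} e w =
      cong (λ b → σ (k (proj₁ (next b)))) (inputs≡ w h) , refl ,
      wired (updateAt-along (head i) (inject-injective (heads ∘ N) i) (inputs≡ w) h _) (works≡ w) ,
      (λ _ → refl) ,
      λ j j≢i v → wired
        (λ g → trans (updateAt-minimal (head j g) (head i h) (inputs C)
                       (inject-disjoint (heads ∘ N) j≢i g h)) (inputs≡ v g))
        (works≡ v)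
    perform-silent i (branchOn j k) σ onPrint {C} e w =
      cong (λ t → σ (k (Tape.scanned t))) (works≡ w j) , refl ,
      wired (inputs≡ w) (works≡ w) , (λ _ → refl) , λ _ _ v → wired (inputs≡ v) (works≡ v)
    perform-silent i (writeTape j s x) σ onPrint {C} e w =
      refl , refl ,
      wired (inputs≡ w) (updateAt-along (work i) (work-injective i) (works≡ w) j _) ,
      (λ g → updateAt-minimal (own g) (work i j) (works C) (↑ˡ≢↑ʳ g _)) ,
      λ h h≢i v → wired (inputs≡ v)
        (λ g → trans (updateAt-minimal (work h g) (work i j) (works C) (work-disjoint h≢i g j)) (works≡ v g))
    perform-silent i (moveTape j d x) σ onPrint {C} e w =
      refl , refl ,
      wired (inputs≡ w) (updateAt-along (work i) (work-injective i) (works≡ w) j _) ,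
      (λ g → updateAt-minimal (own g) (work i j) (works C) (↑ˡ≢↑ʳ g _)) ,
      λ h h≢i v → wired (inputs≡ v)
        (λ g → trans (updateAt-minimal (work h g) (work i j) (works C) (work-disjoint h≢i g j)) (works≡ v g))

    module _ (p : Baire) where

      -- N i after t steps.
      copy : ∀ i → ℕ → Configuration (N i)
      copy i t = run (N i) p t

      -- In C the control state is q, and every N i has performed τ i steps of
      -- its run on p.
      record Tracks (C : Configuration K) (q : Fin c) (τ : Fin k → ℕ) : Set where
        constructor tracks
        field
          control≡ : controlOf (state C) ≡ q
          copies≡  : ∀ i → copiesOf (state C) i ≡ state (copy i (τ i))
          wiring   : ∀ i → Wired i C (copy i (τ i))
      open Tracks

      tracks-start : Tracks (initial K p) start₀ (const 0)
      tracks-start = tracks (controlOf-code _ _) (copiesOf-code _ _) (λ i → wired (λ _ → refl) (λ _ → refl))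

      tracks-tick : ∀ {C C′ q q′ τ i} → Tracks C q τ →
        state C′ ≡ code q′ (set (copiesOf (state C)) i (state (copy i (suc (τ i))))) →
        Wired i C′ (copy i (suc (τ i))) →
        (∀ j → j ≢ i → Undisturbed j C C′) → Tracks C′ q′ (tick i τ)
      tracks-tick {C} {C′} {q} {q′} {τ} {i} tr e w u = tracks
        (trans (cong controlOf e) (controlOf-code q′ _))
        (ticked (λ j t → copiesOf (state C′) j ≡ state (copy j t))
          (trans (copies′ i) (set-same _ i _))
          (λ j j≢i → trans (copies′ j) (trans (set-other _ i _ j≢i) (copies≡ tr j))))
        (ticked (λ j t → Wired j C′ (copy j t)) w (λ j j≢i → u j j≢i (wiring tr j)))
        where
        copies′ : ∀ j → copiesOf (state C′) j ≡ set (copiesOf (state C)) i (state (copy i (suc (τ i)))) j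
        copies′ j = trans (cong (λ x → copiesOf x j) e) (copiesOf-code q′ _ j)

      -- A copy that prints nothing makes a step.
      drive-silent : ∀ {C q τ i} q′ onPrint → Tracks C q τ →
        emissionAt (N i) p (τ i) ≡ nothing →
        let C′ = execute K (drive i q′ (copiesOf (state C)) onPrint) C in
        Tracks C′ q′ (tick i τ) × tally C′ ≡ tally C × (∀ j → works C′ (own j) ≡ works C (own j))
      drive-silent {C} {q} {τ} {i} q′ onPrint tr e
        rewrite copies≡ tr i =
        let (s , t , w , o , u) = perform-silent i (instruction (N i) (copy i (τ i)))
                                    (λ x → code q′ (set (copiesOf (state C)) i x)) onPrint {C} e (wiring tr i)
        in tracks-tick tr s w u , t , o

      drive-emission : ∀ {C q τ i} q′ onPrint → Tracks C q τ →
        emissionAt (N i) p (τ i) ≡ nothing →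
        emission (drive i q′ (copiesOf (state C)) onPrint) ≡ nothing
      drive-emission {C} {q} {τ} {i} q′ onPrint tr e rewrite copies≡ tr i =
        perform-emission i (instruction (N i) (copy i (τ i))) e

      drive-print : ∀ {C q τ i g} q′ onPrint → Tracks C q τ →
        emissionAt (N i) p (τ i) ≡ just g →
        drive i q′ (copiesOf (state C)) onPrint ≡ onPrint g (state (copy i (suc (τ i))))
      drive-print {C} {q} {τ} {i} {g} q′ onPrint tr e
        rewrite copies≡ tr i
        with instruction (N i) (copy i (τ i)) | e
      ... | print stroke x | refl = refl
      ... | print comma x  | refl = refl

      -- If N i prints a glyph, its heads and tapes do not change, and hence those
      -- of the bank need not change either.
      tracks-print : ∀ {C C′ q τ i g} q′ → Tracks C q τ →
        emissionAt (N i) p (τ i) ≡ just g →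
        state C′ ≡ code q′ (set (copiesOf (state C)) i (state (copy i (suc (τ i))))) →
        inputs C′ ≡ inputs C → works C′ ≡ works C →
        Tracks C′ q′ (tick i τ)
      tracks-print {C} {C′} {q} {τ} {i} q′ tr e s refl refl =
        tracks-tick tr s (print-wired (instruction (N i) (copy i (τ i))) e (wiring tr i))
          (λ _ _ v → wired (inputs≡ v) (works≡ v))
        where
        print-wired : ∀ {D g} I → emission I ≡ just g → Wired i C D → Wired i C′ (execute (N i) I D)
        print-wired (print stroke x) e w = wired (inputs≡ w) (works≡ w)
        print-wired (print comma x)  e w = wired (inputs≡ w) (works≡ w)

      -- A step of the control that involves no N i.
      tracks-own : ∀ {C C′ q τ} q′ → Tracks C q τ →
        state C′ ≡ code q′ (copiesOf (state C)) → inputs C′ ≡ inputs C →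
        (∀ i j → works C′ (work i j) ≡ works C (work i j)) → Tracks C′ q′ τ
      tracks-own q′ tr s refl w = tracks
        (trans (cong controlOf s) (controlOf-code q′ _))
        (λ i → trans (cong (λ x → copiesOf x i) s) (trans (copiesOf-code q′ _ i) (copies≡ tr i)))
        (λ i → wired (inputs≡ (wiring tr i)) (λ j → trans (w i j) (works≡ (wiring tr i) j)))

-- Composition of machines

-- Copy suc h of N feeds the head h of M. Copy zero has to print a comma
-- before each comma of M; this makes the composite diverge where N does, even
-- if M reads only a part of its input.
module Composition (M N : Machine) where

  open Bank {suc (heads M)} (const N) (states M) (suc (tapes M))

  -- There is no idle instruction. An additional tape that is never written on
  -- serves to change the state only.
  skip : Fin S → Instruction S H T
  skip x = branchOn (own zero) (const x)

  -- M reads the glyph g printed by copy suc h.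
  serve : (h : Fin (heads M)) → (Glyph → Fin (states M)) → Copies →
          Glyph → Fin (states N) → Instruction S H T
  serve h k f g x = skip (code (k g) (set f (suc h) x))

  -- M prints its comma when copy zero prints one.
  release : Fin (states M) → Fin (states M) → Copies → Glyph → Fin (states N) → Instruction S H T
  release q q′ f stroke x = skip (code q (set f zero x))
  release q q′ f comma  x = print comma (code q′ (set f zero x))

  simulate : Instruction (states M) (heads M) (tapes M) → Fin (states M) → Copies → Instruction S H T
  simulate (readInput h k)    q f = drive (suc h) q f (serve h k f)
  simulate (branchOn j k)     q f = branchOn (own (suc j)) (λ s → code (k s) f)
  simulate (writeTape j s q′) q f = writeTape (own (suc j)) s (code q′ f)
  simulate (moveTape j d q′)  q f = moveTape (own (suc j)) d (code q′ f)
  simulate (print stroke q′)  q f = print stroke (code q′ f)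
  simulate (print comma q′)   q f = drive zero q f (release q q′ f)

  open Controlled (start M) (λ q → simulate (program M q) q) public

  module _ (p : Baire) where

    -- C simulates the configuration E of M, and copy i of N has performed τ i steps.
    -- The input heads of E are virtual: nothing in C corresponds to them.
    record Rep (C : Configuration K) (E : Configuration M) (τ : Fin (suc (heads M)) → ℕ) : Set where
      constructor rep
      field
        tracking : Tracks p C (state E) τ
        mem      : ∀ j → works C (own (suc j)) ≡ works E j
        tallies  : tally C ≡ tally E
    open Rep

    private
      emissionOf : Fin (suc (heads M)) → (Fin (suc (heads M)) → ℕ) → Maybe Glyph
      emissionOf i τ = emissionAt N p (τ i)

      advance : ∀ {C E τ I} → Rep C E τ → instruction M E ≡ I →
        step K C ≡ execute K (simulate I (state E) (copiesOf (state C))) C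
      advance {C} r refl = cong (λ q → execute K (simulate (program M q) q (copiesOf (state C))) C)
        (Tracks.control≡ (tracking r))

    -- The effect of one step of the composite, when M is about to read with head
    -- h and copy suc h prints nothing (wait) or a glyph (read), or when M is about to
    -- print a comma and copy zero prints no comma (wait₀) or a comma (finish).
    wait : ∀ {C E τ h k} → Rep C E τ → instruction M E ≡ readInput h k →
      emissionOf (suc h) τ ≡ nothing → Rep (step K C) E (tick (suc h) τ)
    wait {C} {E} {τ} {h} {k} r I e =
      subst (λ C′ → Rep C′ E (tick (suc h) τ)) (sym (advance r I))
        (let (t , y , o) = drive-silent p (state E) (serve h k (copiesOf (state C))) (tracking r) e
         in rep t (λ j → trans (o (suc j)) (mem r j)) (trans y (tallies r)))

    wait₀ : ∀ {C E τ q} → Rep C E τ → instruction M E ≡ print comma q →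
      emissionOf zero τ ≢ just comma → Rep (step K C) E (tick zero τ)
    wait₀ {C} {E} {τ} {q} r I e =
      subst (λ C′ → Rep C′ E (tick zero τ)) (sym (advance r I)) (go (emissionOf zero τ) refl)
      where
      C′ : Configuration K
      C′ = execute K (simulate (print comma q) (state E) (copiesOf (state C))) C

      go : ∀ g → emissionOf zero τ ≡ g → Rep C′ E (tick zero τ)
      go nothing eq =
        let (t , y , o) = drive-silent p (state E) (release (state E) q (copiesOf (state C))) (tracking r) eq
        in rep t (λ j → trans (o (suc j)) (mem r j)) (trans y (tallies r))
      go (just stroke) eq
        rewrite drive-print p (state E) (release (state E) q (copiesOf (state C))) (tracking r) eq =
        rep (tracks-print p (state E) (tracking r) eq refl refl refl) (mem r) (tallies r)
      go (just comma) eq = ⊥-elim (e eq)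

    -- Since the heads of E are virtual, i can be chosen at will.
    read : ∀ {C E τ h k g} i → Rep C E τ → instruction M E ≡ readInput h k →
      emissionOf (suc h) τ ≡ just g →
      Rep (step K C) (config (k g) i (works E) (written E) (pending E)) (tick (suc h) τ)
    read {C} {E} {τ} {h} {k} {g} i r I e
      rewrite advance r I | drive-print p (state E) (serve h k (copiesOf (state C))) (tracking r) e =
      rep (tracks-print p (k g) (tracking r) e refl refl refl) (mem r) (tallies r)

    finish : ∀ {C E τ q} → Rep C E τ → instruction M E ≡ print comma q →
      emissionOf zero τ ≡ just comma → Rep (step K C) (step M E) (tick zero τ)
    finish {C} {E} {τ} {q} r I e
      rewrite advance r I | I
            | drive-print p (state E) (release (state E) q (copiesOf (state C))) (tracking r) e =
      rep (tracks-print p q (tracking r) e refl refl refl) (mem r) (cong (emit (just comma)) (tallies r))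

    -- The instructions of M that need no copy of N.
    data Own : Instruction (states M) (heads M) (tapes M) → Set where
      branching : ∀ j k → Own (branchOn j k)
      writing   : ∀ j s q → Own (writeTape j s q)
      moving    : ∀ j d q → Own (moveTape j d q)
      stroking  : ∀ q → Own (print stroke q)

    operate : ∀ {C E τ} → Rep C E τ → Own (instruction M E) → Rep (step K C) (step M E) τ
    operate {C} {E} {τ} r o = subst (λ C′ → Rep C′ (step M E) τ) (sym (advance r refl)) (go _ o)
      where
      updated : ∀ j {f : Tape → Tape} i x →
                updateAt (works C) (own (suc j)) f (work i x) ≡ works C (work i x)
      updated j i x = updateAt-minimal (work i x) (own (suc j)) (works C) (↑ˡ≢↑ʳ (suc j) _ ∘ sym)

      go : ∀ I → Own I →
           Rep (execute K (simulate I (state E) (copiesOf (state C))) C) (execute M I E) τ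
      go _ (branching j k) =
        rep (tracks-own p (k (Tape.scanned (works E j))) (tracking r)
              (cong (λ t → code (k (Tape.scanned t)) (copiesOf (state C))) (mem r j)) refl (λ _ _ → refl))
            (mem r) (tallies r)
      go _ (writing j s q) =
        rep (tracks-own p q (tracking r) refl refl (updated j))
            (updateAt-along (own ∘ suc) (suc-injective ∘ ↑ˡ-injective _ _ _) {works C} (mem r) j _) (tallies r)
      go _ (moving j d q) =
        rep (tracks-own p q (tracking r) refl refl (updated j))
            (updateAt-along (own ∘ suc) (suc-injective ∘ ↑ˡ-injective _ _ _) {works C} (mem r) j _) (tallies r)
      go _ (stroking q) =
        rep (tracks-own p q (tracking r) refl refl (λ _ _ → refl)) (mem r) (cong (emit (just stroke)) (tallies r))

    rep-start : ∀ s → Rep (initial K p) (initial M s) (const 0)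
    rep-start s = rep (tracks-start p) (λ _ → refl) refl

    -- Instructions of M according to the copy of N they depend on.
    data View : Instruction (states M) (heads M) (tapes M) → Set where
      reads    : ∀ h k → View (readInput h k)
      forces   : ∀ q → View (print comma q)
      internal : ∀ {I} → Own I → View I

    view : ∀ I → View I
    view (readInput h k)   = reads h k
    view (branchOn j k)    = internal (branching j k)
    view (writeTape j s q) = internal (writing j s q)
    view (moveTape j d q)  = internal (moving j d q)
    view (print stroke q)  = internal (stroking q)
    view (print comma q)   = forces q

    -- The composite has completed as many blocks as copy zero of N. As N is not
    -- assumed to be productive, there is no sequence that M could be said to run
    -- on; the initial contents of the virtual heads are arbitrary.
    Forced : ℕ → Set
    Forced t = ∃[ E ] ∃[ τ ] Rep (run K p t) E τ × length (written E) ≡ count N p (τ zero)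

    forced : ∀ t → Forced t
    forced zero    = initial M p , const 0 , rep-start p , refl
    forced (suc t) with forced t
    ... | E , τ , r , e = by (instruction M E) refl (view (instruction M E))
      where
      idle : ∀ {g} → emissionAt N p (τ zero) ≡ g → g ≢ just comma →
             length (written E) ≡ count N p (tick zero τ zero)
      idle refl ¬c = trans e (sym (trans (run-count N p (τ zero)) (commas-idle ¬c _)))

      by : ∀ I → instruction M E ≡ I → View I → Forced (suc t)
      by _ I (reads h k) with emissionAt N p (τ (suc h)) in eq
      ... | nothing = E , _ , wait r I eq , e
      ... | just g  = _ , _ , read (inputs E) r I eq , e
      by _ I (forces q) with comma? (emissionAt N p (τ zero))
      ... | no ¬c = E , _ , wait₀ r I ¬c , idle refl ¬c
      ... | yes c = step M E , _ , finish r I c , (begin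
        length (written (step M E))                 ≡⟨ cong (length ∘ proj₁) (execute-tally M (instruction M E) E) ⟩
        length (proj₁ (emit (emission (instruction M E)) (tally E)))
          ≡⟨ cong (λ J → length (proj₁ (emit (emission J) (tally E)))) I ⟩
        length (proj₁ (emit (just comma) (tally E)))  ≡⟨ emit-count (just comma) (tally E) ⟩
        suc (length (written E))                    ≡⟨ cong suc e ⟩
        suc (count N p (τ zero))                    ≡⟨ cong (λ g → commas g (count N p (τ zero))) c ⟨
        commas (emissionAt N p (τ zero)) (count N p (τ zero)) ≡⟨ run-count N p (τ zero) ⟨
        count N p (suc (τ zero))                    ∎)
        where open ≡-Reasoning
      by _ refl (internal o) = step M E , τ , operate r o , trans (same o) e
        where
        same : ∀ {I} → Own I → length (written (execute M I E)) ≡ length (written E)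
        same (branching _ _) = refl
        same (writing _ _ _) = refl
        same (moving _ _ _)  = refl
        same (stroking _)    = refl

    productive-inner : Productive K p → Productive N p
    productive-inner prod n =
      let (t , n≤)        = prod n
          (E , τ , r , e) = forced t
      in τ zero , ≤-trans n≤ (≤-reflexive (trans (cong (length ∘ proj₁) (tallies r)) e))

    -- Where N computes s, the composite simulates the run of M on s.
    module _ {s : Baire} (d : N ⊢ p ↦ s) where

      -- What the heads of E have not read is what the copies have still to print.
      Fed : Configuration M → (Fin (suc (heads M)) → ℕ) → Set
      Fed E τ = ∀ h → inputs E h ≗ rest d (τ (suc h))

      -- E is simulated at time t or later.
      Reached : ℕ → Configuration M → Set
      Reached t E = ∃[ t′ ] t ≤ t′ × ∃[ τ ] Rep (run K p t′) E τ × Fed E τ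

      later : ∀ {t E} → Reached (suc t) E → Reached t E
      later (t′ , t< , x) = t′ , <⇒≤ t< , x

      by-comma : (P : ℕ → Set) →
        (∀ t → emissionAt N p t ≡ just comma → P t) →
        (∀ t → emissionAt N p t ≢ just comma → P (suc t) → P t) → ∀ t → P t
      by-comma = comma-induction N p (↦⇒productive d)

      -- Copy suc h, after u steps, prints its next glyph at the next comma at the
      -- latest, and M reads it.
      reading : ∀ {E h k} → instruction M E ≡ readInput h k → ∀ u {t τ} → τ (suc h) ≡ u →
                Rep (run K p t) E τ → Fed E τ → Reached (suc t) (step M E)
      reading {E} {h} {k} I = by-comma _
        (λ { u c refl r f → got refl c r f })
        (λ { u _ go refl r f → not-yet go r f })
        where
        P : ℕ → Set
        P u = ∀ {t τ} → τ (suc h) ≡ u → Rep (run K p t) E τ → Fed E τ → Reached (suc t) (step M E)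

        got : ∀ {u g t τ} → τ (suc h) ≡ u → emissionAt N p u ≡ just g →
              Rep (run K p t) E τ → Fed E τ → Reached (suc t) (step M E)
        got {g = g} {t} {τ} refl e r f =
          suc t , ≤-refl , tick (suc h) τ ,
          subst (λ E′ → Rep (run K p (suc t)) E′ (tick (suc h) τ)) (sym stepped)
            (read (updateAt (inputs E) h (proj₂ ∘ next)) r I e) ,
          subst (λ E′ → Fed E′ (tick (suc h) τ)) (sym stepped) fed
          where
          pushed : proj₁ (next (inputs E h)) ≡ g × proj₂ (next (inputs E h)) ≗ rest d (suc (τ (suc h)))
          pushed = next-push g λ i → trans (f h i) (trans (rest-step d (τ (suc h)) i)
            (cong (λ x → push x (rest d (suc (τ (suc h)))) i) e))

          stepped : step M E ≡ config (k g) (updateAt (inputs E) h (proj₂ ∘ next))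
                                      (works E) (written E) (pending E)
          stepped = trans (cong (λ J → execute M J E) I)
            (cong (λ x → config (k x) _ (works E) (written E) (pending E)) (proj₁ pushed))

          fed : ∀ j → updateAt (inputs E) h (proj₂ ∘ next) j ≗ rest d (tick (suc h) τ (suc j))
          fed j with j ≟ h
          ... | yes refl = λ i → trans (cong (λ b → b i) (updateAt-updates h (inputs E)))
            (trans (proj₂ pushed i)
              (cong (λ u → rest d u i) (sym (updateAt-updates (suc h) τ))))
          ... | no j≢h = λ i → trans (cong (λ b → b i) (updateAt-minimal j h (inputs E) j≢h))
            (trans (f j i)
              (cong (λ u → rest d u i) (sym (updateAt-minimal (suc j) (suc h) τ (j≢h ∘ suc-injective)))))

        not-yet : ∀ {t τ} → P (suc (τ (suc h))) → Rep (run K p t) E τ → Fed E τ → Reached (suc t) (step M E)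
        not-yet {t} {τ} go r f with emissionAt N p (τ (suc h)) in e
        ... | just g  = got refl e r f
        ... | nothing = later (go (updateAt-updates (suc h) τ) (wait r I e) fed)
          where
          fed : Fed E (tick (suc h) τ)
          fed j with j ≟ h
          ... | yes refl = λ i → trans (f h i) (trans (rest-step d (τ (suc h)) i)
            (trans (cong (λ x → push x (rest d (suc (τ (suc h)))) i) e)
              (cong (λ u → rest d u i) (sym (updateAt-updates (suc h) τ)))))
          ... | no j≢h = λ i → trans (f j i)
              (cong (λ u → rest d u i) (sym (updateAt-minimal (suc j) (suc h) τ (j≢h ∘ suc-injective))))

      -- Copy zero, after u steps, reaches its next comma, and M prints its own.
      releasing : ∀ {E q} → instruction M E ≡ print comma q → ∀ u {t τ} → τ zero ≡ u →
                  Rep (run K p t) E τ → Fed E τ → Reached (suc t) (step M E)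
      releasing {E} {q} I = by-comma _
        (λ { u c {t} {τ} refl r f → suc t , ≤-refl , tick zero τ , finish r I c ,
               λ h → subst (λ E′ → inputs E′ h ≗ rest d (τ (suc h))) (sym (cong (λ J → execute M J E) I)) (f h) })
        (λ { u ¬c go {t} {τ} refl r f → later (go refl (wait₀ r I ¬c) f) })

      progress : ∀ {t E τ} → Rep (run K p t) E τ → Fed E τ → Reached (suc t) (step M E)
      progress {t} {E} {τ} r f = by (instruction M E) refl (view (instruction M E))
        where
        by : ∀ I → instruction M E ≡ I → View I → Reached (suc t) (step M E)
        by _ I (reads h k)   = reading I (τ (suc h)) refl r f
        by _ I (forces q)    = releasing I (τ zero) refl r f
        by _ refl (internal o) = suc t , ≤-refl , τ , operate r o , unread o
          where
          unread : ∀ {I} → Own I → Fed (execute M I E) τ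
          unread (branching _ _) = f
          unread (writing _ _ _) = f
          unread (moving _ _ _)  = f
          unread (stroking _)    = f

      -- The bound u on the time matters for productive-outer: when the composite
      -- has simulated u steps of M, it has itself performed at least u.
      simulation : ∀ u → Reached u (run M s u)
      simulation zero    = 0 , z≤n , const 0 , rep-start s , λ h i → sym (rest-start d i)
      simulation (suc u) =
        let (t , u≤t , τ , r , f)   = simulation u
            (t′ , t<t′ , x) = progress r f
        in t′ , ≤-trans (s≤s u≤t) t<t′ , x

      output-simulation : ∀ u → ∃[ t ] u ≤ t × output K p t ≡ output M s u
      output-simulation u = let (t , u≤t , τ , r , _) = simulation u in t , u≤t , cong proj₁ (tallies r)

      outer⇒composite : ∀ {r} → M ⊢ s ↦ r → K ⊢ p ↦ r
      outer⇒composite d′ n =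
        let (u , e)     = d′ n
            (t , _ , f) = output-simulation u
        in t , trans f e

      productive-outer : Productive K p → Productive M s
      productive-outer prod n =
        let (u , n≤)      = prod n
            (t , u≤t , e) = output-simulation u
        in u , ≤-trans n≤ (≤-trans (count-mono K p u≤t) (≤-reflexive (cong length e)))

  -- If the composite is productive on p then so is N, because of copy zero; let
  -- s be its output. Then M is productive on s, and the converse
  -- implication shows that its output there is the output of the composite.
  composite-spec : ∀ {p r} → (K ⊢ p ↦ r) ⇔ (∃[ s ] (N ⊢ p ↦ s) × (M ⊢ s ↦ r))
  composite-spec {p} {r} = mk⇔ analysis λ (s , d , d′) → outer⇒composite p d d′
    where
    analysis : K ⊢ p ↦ r → ∃[ s ] (N ⊢ p ↦ s) × (M ⊢ s ↦ r)
    analysis dK =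
      let prod     = ↦⇒productive dK
          (s , d)  = productive⇒↦ (productive-inner p prod)
          (_ , d′) = productive⇒↦ (productive-outer p d prod)
      in s , d , ↦-cong M (λ _ → refl) (↦-functional K (outer⇒composite p d d′) dK) d′

-- Pairing of machines

other : Fin 2 → Fin 2
other zero       = suc zero
other (suc zero) = zero

other-≢ : ∀ b → other b ≢ b
other-≢ zero       ()
other-≢ (suc zero) ()

other-other : ∀ b → other (other b) ≡ b
other-other zero       = refl
other-other (suc zero) = refl

-- The two machines take turns, with a change after each comma.
turn : Maybe Glyph → Fin 2 → Fin 2
turn (just comma) b = other b
turn _            b = b

turn-idle : ∀ {e} → e ≢ just comma → ∀ b → turn e b ≡ b
turn-idle {nothing}     _ b = refl
turn-idle {just stroke} _ b = refl
turn-idle {just comma}  c b = ⊥-elim (c refl)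

-- The numbers of blocks completed by the two machines and by the pair, when it
-- is the turn of b: machine 0 is ahead by one block in the turn of machine 1.
Balanced : Fin 2 → (Fin 2 → ℕ) → ℕ → Set
Balanced b c n = c zero ≡ toℕ b + c (suc zero) × n ≡ c zero + c (suc zero)

balance-step : ∀ b e {c c′ n n′} → c′ b ≡ commas e (c b) → c′ (other b) ≡ c (other b) →
  n′ ≡ commas e n → Balanced b c n → Balanced (turn e b) c′ n′
balance-step zero       nothing       p q r (x , y) rewrite p | q | r = x , y
balance-step (suc zero) nothing       p q r (x , y) rewrite p | q | r = x , y
balance-step zero       (just stroke) p q r (x , y) rewrite p | q | r = x , y
balance-step (suc zero) (just stroke) p q r (x , y) rewrite p | q | r = x , y
balance-step zero       (just comma)  p q r (x , y) rewrite p | q | r = cong suc x , cong suc y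
balance-step (suc zero) (just comma) {c} p q r (x , y) rewrite p | q | r =
  x , trans (cong suc y) (sym (+-suc (c zero) _))

balanced-≤ : ∀ b i n {c m} → Balanced b c m → suc (n + n) ≤ m → n ≤ c i
balanced-≤ b i n {c} {m} (x , y) n≤ = ≮⇒≥ λ c< → <⇒≱ n≤ (≤-pred (begin
  suc m                                       ≡⟨ cong suc y ⟩
  suc (c zero + c (suc zero))                 ≤⟨ small i b x c< ⟩
  suc (n + n)                                 ∎))
  where
  open ≤-Reasoning
  small : ∀ i b → c zero ≡ toℕ b + c (suc zero) → c i < n → suc (c zero + c (suc zero)) ≤ suc (n + n)
  small zero zero x c< rewrite sym x = s≤s (+-mono-≤ (<⇒≤ c<) (<⇒≤ c<))
  small zero (suc zero) x c< = s≤s (+-mono-≤ (<⇒≤ c<) (≤-trans (n≤1+n _) (≤-trans (≤-reflexive (sym x)) (<⇒≤ c<))))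
  small (suc zero) zero x c< rewrite x = s≤s (+-mono-≤ (<⇒≤ c<) (<⇒≤ c<))
  small (suc zero) (suc zero) x c< rewrite x = s≤s (+-mono-≤ c< (<⇒≤ c<))

-- In ⟨_,_⟩ the first block of the first sequence is followed by the pair
-- taken in the other order, in accordance with a change of turns at each comma.
push-pair : ∀ e b (f : Fin 2 → Baire) →
  ⟨ push e (f b) , f (other b) ⟩ ≗ push e ⟨ f (turn e b) , f (other (turn e b)) ⟩
push-pair nothing       b f i       = refl
push-pair (just stroke) b f zero    = refl
push-pair (just stroke) b f (suc i) = refl
push-pair (just comma)  b f zero    = refl
push-pair (just comma)  b f (suc i) =
  cong (λ b′ → ⟨ f (other b) , f b′ ⟩ i) (sym (other-other b))

both : Machine → Machine → Fin 2 → Machine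
both A B zero       = A
both A B (suc zero) = B

-- The output of the machine whose turn it is gets copied, up to its next comma.
module Pairing (A B : Machine) where

  N : Fin 2 → Machine
  N = both A B

  open Bank N 2 0

  copyOut : Fin 2 → Copies → (b : Fin 2) → Glyph → Fin (states (N b)) → Instruction S H T
  copyOut b f b′ g x = print g (code (turn (just g) b) (set f b′ x))

  open Controlled zero (λ b f → drive b b f (copyOut b f b)) public

  module _ (p : Baire) where

    pair-step : ∀ {C b τ} → Tracks p C b τ → let e = emissionAt (N b) p (τ b) in
      Tracks p (step K C) (turn e b) (tick b τ) × emission (instruction K C) ≡ e
    pair-step {C} {b} {τ} tr with emissionAt (N b) p (τ b) in eq
    ... | nothing rewrite Tracks.control≡ tr =
      proj₁ (drive-silent p b (copyOut b (copiesOf (state C)) b) tr eq) ,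
      drive-emission p b (copyOut b (copiesOf (state C)) b) tr eq
    ... | just stroke
      rewrite Tracks.control≡ tr | drive-print p b (copyOut b (copiesOf (state C)) b) tr eq =
      tracks-print p b tr eq refl refl refl , refl
    ... | just comma
      rewrite Tracks.control≡ tr | drive-print p b (copyOut b (copiesOf (state C)) b) tr eq =
      tracks-print p (other b) tr eq refl refl refl , refl

    -- At time t it is the turn of machine phase t, and machine i has performed
    -- clock t i steps.
    phase : ℕ → Fin 2
    clock : ℕ → Fin 2 → ℕ
    active : ℕ → Maybe Glyph
    active t = emissionAt (N (phase t)) p (clock t (phase t))
    phase zero    = zero
    phase (suc t) = turn (active t) (phase t)
    clock zero    = const 0
    clock (suc t) = tick (phase t) (clock t)

    tracking : ∀ t → Tracks p (run K p t) (phase t) (clock t)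
    tracking zero    = tracks-start p
    tracking (suc t) = proj₁ (pair-step (tracking t))

    emission-K : ∀ t → emissionAt K p t ≡ active t
    emission-K t = proj₂ (pair-step (tracking t))

    countOf : ℕ → Fin 2 → ℕ
    countOf t i = count (N i) p (clock t i)

    clock-self : ∀ t → clock (suc t) (phase t) ≡ suc (clock t (phase t))
    clock-self t = updateAt-updates (phase t) (clock t)

    clock-other : ∀ t {i} → i ≢ phase t → clock (suc t) i ≡ clock t i
    clock-other t = updateAt-minimal _ (phase t) (clock t)

    count-self : ∀ t → countOf (suc t) (phase t) ≡ commas (active t) (countOf t (phase t))
    count-self t = trans (cong (count (N (phase t)) p) (clock-self t))
      (run-count (N (phase t)) p (clock t (phase t)))

    count-other : ∀ t {i} → i ≢ phase t → countOf (suc t) i ≡ countOf t i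
    count-other t {i} i≢b = cong (count (N i) p) (clock-other t i≢b)

    count-K : ∀ t → count K p (suc t) ≡ commas (active t) (count K p t)
    count-K t = trans (run-count K p t) (cong (λ e → commas e (count K p t)) (emission-K t))

    balanced : ∀ t → Balanced (phase t) (countOf t) (count K p t)
    balanced zero    = refl , refl
    balanced (suc t) = balance-step (phase t) (active t) {countOf t} {countOf (suc t)} (count-self t)
      (count-other t (other-≢ (phase t))) (count-K t) (balanced t)

    -- Among the first n + n + 1 blocks, at least n come from either machine.
    productive-component : Productive K p → ∀ i → Productive (N i) p
    productive-component prod i n =
      let (t , n≤) = prod (suc (n + n)) in clock t i , balanced-≤ (phase t) i n {countOf t} (balanced t) n≤

    module _ (prod : ∀ i → Productive (N i) p) where

      More : ℕ → Set
      More t = ∃[ t′ ] count K p t′ ≡ suc (count K p t)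

      -- Wait for the next comma of the machine whose turn it is at time t.
      more : ∀ t → More t
      more t = comma-induction (N (phase t)) p (prod (phase t))
        (λ u → ∀ t′ → phase t′ ≡ phase t → clock t′ (phase t) ≡ u → More t′)
        (λ { u c t′ b refl → suc t′ , trans (count-K t′) (cong (λ e → commas e (count K p t′)) (here t′ b c)) })
        (λ { u ¬c go t′ b refl →
               let ¬c′ : active t′ ≢ just comma
                   ¬c′ c = ¬c (subst (λ b → emissionAt (N b) p (clock t′ b) ≡ just comma) b c)
                   (t″ , e) = go (suc t′) (trans (turn-idle ¬c′ (phase t′)) b)
                     (trans (cong (clock (suc t′)) (sym b)) (trans (clock-self t′) (cong (suc ∘ clock t′) b)))
               in t″ , trans e (cong suc (trans (count-K t′) (commas-idle ¬c′ _))) })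
        (clock t (phase t)) t refl refl
        where
        here : ∀ t′ → phase t′ ≡ phase t → emissionAt (N (phase t)) p (clock t′ (phase t)) ≡ just comma →
               active t′ ≡ just comma
        here t′ b = subst (λ b → emissionAt (N b) p (clock t′ b) ≡ just comma) (sym b)

      productive-pair : Productive K p
      productive-pair zero    = 0 , z≤n
      productive-pair (suc n) =
        let (t , n≤) = productive-pair n
            (t′ , e) = more t
        in t′ , ≤-trans (s≤s n≤) (≤-reflexive (sym e))

    module _ {r : Fin 2 → Baire} (d : ∀ i → N i ⊢ p ↦ r i) where

      unread : ℕ → Fin 2 → Baire
      unread t i = rest (d i) (clock t i)

      unread-self : ∀ t → unread t (phase t) ≗ push (active t) (unread (suc t) (phase t))
      unread-self t i = trans (rest-step (d (phase t)) (clock t (phase t)) i)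
        (cong (λ u → push (active t) (rest (d (phase t)) u) i) (sym (clock-self t)))

      unread-other : ∀ t → unread t (other (phase t)) ≗ unread (suc t) (other (phase t))
      unread-other t i = cong (λ u → rest (d (other (phase t))) u i) (sym (clock-other t (other-≢ (phase t))))

      -- What the pair has still to print at time t.
      pending-pair : ℕ → Baire
      pending-pair t = ⟨ unread t (phase t) , unread t (other (phase t)) ⟩

      pending-step : ∀ t → pending-pair t ≗ push (emissionAt K p t) (pending-pair (suc t))
      pending-step t i = trans
        (⟨,⟩-cong {unread t (phase t)} (unread-self t) (unread-other t) i)
        (trans (push-pair (active t) (phase t) (unread (suc t)) i)
          (cong (λ e → push e (pending-pair (suc t)) i) (sym (emission-K t))))

      components⇒pair : K ⊢ p ↦ ⟨ r zero , r (suc zero) ⟩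
      components⇒pair = unfold⇒↦ K pending-pair
        (⟨,⟩-cong {unread 0 zero} (rest-start (d zero)) (rest-start (d (suc zero))))
        pending-step (productive-pair (λ i → ↦⇒productive (d i)))

  pair-spec : ∀ {p r} → (K ⊢ p ↦ r) ⇔ (∃[ s ] ∃[ t ] (A ⊢ p ↦ s) × (B ⊢ p ↦ t) × ⟨ s , t ⟩ ≗ r)
  pair-spec {p} {r} = mk⇔ analysis λ (s , t , d , d′ , e) →
    ↦-cong K (λ _ → refl) e (components⇒pair p {pairOf s t} λ { zero → d ; (suc zero) → d′ })
    where
    pairOf : Baire → Baire → Fin 2 → Baire
    pairOf s t zero       = s
    pairOf s t (suc zero) = t

    analysis : K ⊢ p ↦ r → ∃[ s ] ∃[ t ] (A ⊢ p ↦ s) × (B ⊢ p ↦ t) × ⟨ s , t ⟩ ≗ r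
    analysis dK =
      let component : ∀ i → ∃[ s ] N i ⊢ p ↦ s
          component i = productive⇒↦ (productive-component p (↦⇒productive dK) i)
      in proj₁ (component zero) , proj₁ (component (suc zero)) ,
         proj₂ (component zero) , proj₂ (component (suc zero)) ,
         ↦-functional K (components⇒pair p {λ i → proj₁ (component i)} (λ i → proj₂ (component i))) dK

-- Projections

evens odds : Baire → Baire
evens p zero    = p 0
evens p (suc n) = evens (tail (tail p)) n
odds p = evens (tail p)

evens-pair : ∀ p q → evens ⟨ p , q ⟩ ≗ p
evens-pair p q zero    = refl
evens-pair p q (suc n) = evens-pair (tail p) (tail q) n

odds-pair : ∀ p q → odds ⟨ p , q ⟩ ≗ q
odds-pair p q = evens-pair q (tail p)

pair-split : ∀ p → ⟨ evens p , odds p ⟩ ≗ p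
pair-split p zero    = refl
pair-split p (suc n) = pair-split (tail p) n

next-zero : ∀ p → p 0 ≡ 0 → proj₁ (next p) ≡ comma
next-zero p e with p 0
next-zero p refl | zero = refl

next-suc : ∀ p {m} → p 0 ≡ suc m → proj₁ (next p) ≡ stroke × proj₂ (next p) 0 ≡ m
next-suc p e with p 0
next-suc p refl | suc m = refl , refl

-- A machine that copies every other block. Started in the state copying it
-- extracts the terms with even index, started in skipping those with odd index.
module Projection where

  -- copied and ended: a stroke, respectively a comma, has been read in the state
  -- copying and is to be printed.
  copying copied ended skipping : Fin 4
  copying  = zero
  copied   = suc zero
  ended    = suc (suc zero)
  skipping = suc (suc (suc zero))

  afterCopying afterSkipping : Glyph → Fin 4
  afterCopying stroke = copied
  afterCopying comma  = ended
  afterSkipping stroke = skipping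
  afterSkipping comma  = copying

  alternate : Fin 4 → Instruction 4 1 0
  alternate zero                   = readInput zero afterCopying
  alternate (suc zero)             = print stroke copying
  alternate (suc (suc zero))       = print comma skipping
  alternate (suc (suc (suc zero))) = readInput zero afterSkipping

  selector : Fin 4 → Machine
  selector q = record { states = 4 ; heads = 1 ; tapes = 0 ; start = q ; program = alternate }

  -- What is printed from a given state if b has not been read yet.
  future : Fin 4 → Baire → Baire
  future zero                   b = evens b
  future (suc zero)             b = push (just stroke) (evens b)
  future (suc (suc zero))       b = push (just comma) (odds b)
  future (suc (suc (suc zero))) b = odds b

  module _ (q : Fin 4) where

    ahead : Configuration (selector q) → Baire
    ahead C = future (state C) (inputs C zero)

    ahead-step : ∀ C → ahead C ≗ push (emission (alternate (state C))) (ahead (step (selector q) C))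
    ahead-step (config zero i _ _ _) n with i zero 0 in e
    ahead-step (config zero i _ _ _) zero    | zero  = e
    ahead-step (config zero i _ _ _) (suc n) | zero  = refl
    ahead-step (config zero i _ _ _) zero    | suc m = e
    ahead-step (config zero i _ _ _) (suc n) | suc m = refl
    ahead-step (config (suc zero) i _ _ _)             n = refl
    ahead-step (config (suc (suc zero)) i _ _ _)       n = refl
    ahead-step (config (suc (suc (suc zero))) i _ _ _) n with i zero 0
    ... | zero  = refl
    ... | suc m = refl

    steps : ℕ → Configuration (selector q) → Configuration (selector q)
    steps zero    C = C
    steps (suc d) C = steps d (step (selector q) C)

    steps-run : ∀ p d t → steps d (run (selector q) p t) ≡ run (selector q) p (d + t)
    steps-run p zero    t = refl
    steps-run p (suc d) t = trans (steps-run p d (suc t)) (cong (run (selector q) p) (+-suc d t))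

    -- Some later configuration has completed exactly one more block.
    Grows : Configuration (selector q) → Set
    Grows C = ∃[ d ] length (written (steps d C)) ≡ suc (length (written C))

    -- A step that completes no block.
    grows-later : ∀ C → length (written (step (selector q) C)) ≡ length (written C) →
                  Grows (step (selector q) C) → Grows C
    grows-later C e (d , f) = suc d , trans f (cong suc e)

    grows-ended : ∀ i w o n → Grows (config ended i w o n)
    grows-ended i w o n = 1 , emit-count (just comma) (o , n)

    -- The head after reading a glyph.
    past : Vector Baire 1 → Vector Baire 1
    past i = updateAt i zero (proj₂ ∘ next)

    grows-copying : ∀ m i w o n → i zero 0 ≡ m → Grows (config copying i w o n)
    grows-copying zero    i w o n e = grows-later _ refl
      (subst (λ g → Grows (config (afterCopying g) (past i) w o n)) (sym (next-zero (i zero) e))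
        (grows-ended (past i) w o n))
    grows-copying (suc m) i w o n e = grows-later _ refl
      (subst (λ g → Grows (config (afterCopying g) (past i) w o n)) (sym (proj₁ (next-suc (i zero) e)))
        (grows-later _ refl (grows-copying m (past i) w o (suc n) (proj₂ (next-suc (i zero) e)))))

    grows-skipping : ∀ m i w o n → i zero 0 ≡ m → Grows (config skipping i w o n)
    grows-skipping zero    i w o n e = grows-later _ refl
      (subst (λ g → Grows (config (afterSkipping g) (past i) w o n)) (sym (next-zero (i zero) e))
        (grows-copying _ (past i) w o n refl))
    grows-skipping (suc m) i w o n e = grows-later _ refl
      (subst (λ g → Grows (config (afterSkipping g) (past i) w o n)) (sym (proj₁ (next-suc (i zero) e)))
        (grows-skipping m (past i) w o n (proj₂ (next-suc (i zero) e))))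

    grows : ∀ C → Grows C
    grows (config zero i w o n)                   = grows-copying _ i w o n refl
    grows (config (suc zero) i w o n)             = grows-later _ refl (grows-copying _ i w o (suc n) refl)
    grows (config (suc (suc zero)) i w o n)       = grows-ended i w o n
    grows (config (suc (suc (suc zero))) i w o n) = grows-skipping _ i w o n refl

    productive-selector : ∀ p → Productive (selector q) p
    productive-selector p zero    = 0 , z≤n
    productive-selector p (suc n) =
      let (t , n≤) = productive-selector p n
          (d , e)  = grows (run (selector q) p t)
      in d + t , ≤-trans (s≤s n≤) (≤-reflexive (sym
           (trans (cong (length ∘ written) (sym (steps-run p d t))) e)))

    selects : ∀ p → selector q ⊢ p ↦ future q p
    selects p = unfold⇒↦ (selector q) (λ t → ahead (run (selector q) p t)) (λ _ → refl)
      (λ t → ahead-step (run (selector q) p t)) (productive-selector p)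

-- Machines as combinators

infixr 9 _∘ᴹ_
infixr 5 _,ᴹ_

-- The combinators are abstract, so that machines can be inferred from the
-- relations they compute.
abstract

  _∘ᴹ_ : Machine → Machine → Machine
  M ∘ᴹ N = Composition.K M N

  ∘-intro : ∀ {M N p s r} → N ⊢ p ↦ s → M ⊢ s ↦ r → M ∘ᴹ N ⊢ p ↦ r
  ∘-intro {M} {N} {p} {s} {r} d d′ = Equivalence.from (Composition.composite-spec M N {p} {r}) (s , d , d′)

  ∘-elim : ∀ {M N p r} → M ∘ᴹ N ⊢ p ↦ r → ∃[ s ] (N ⊢ p ↦ s) × (M ⊢ s ↦ r)
  ∘-elim {M} {N} {p} {r} = Equivalence.to (Composition.composite-spec M N {p} {r})

  _,ᴹ_ : Machine → Machine → Machine
  A ,ᴹ B = Pairing.K A B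

  ,-intro : ∀ {A B p s t} → A ⊢ p ↦ s → B ⊢ p ↦ t → A ,ᴹ B ⊢ p ↦ ⟨ s , t ⟩
  ,-intro {A} {B} {p} {s} {t} d d′ =
    Equivalence.from (Pairing.pair-spec A B {p} {⟨ s , t ⟩}) (s , t , d , d′ , λ _ → refl)

  ,-elim : ∀ {A B p r} → A ,ᴹ B ⊢ p ↦ r → ∃[ s ] ∃[ t ] (A ⊢ p ↦ s) × (B ⊢ p ↦ t) × ⟨ s , t ⟩ ≗ r
  ,-elim {A} {B} {p} {r} = Equivalence.to (Pairing.pair-spec A B {p} {r})

  fstᴹ sndᴹ : Machine
  fstᴹ = Projection.selector Projection.copying
  sndᴹ = Projection.selector Projection.skipping

  fst-↦ : ∀ {p q} → fstᴹ ⊢ ⟨ p , q ⟩ ↦ p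
  fst-↦ {p} {q} = ↦-cong fstᴹ (λ _ → refl) (evens-pair p q) (Projection.selects _ _)

  snd-↦ : ∀ {p q} → sndᴹ ⊢ ⟨ p , q ⟩ ↦ q
  snd-↦ {p} {q} = ↦-cong sndᴹ (λ _ → refl) (odds-pair p q) (Projection.selects _ _)

-- Elimination when the output of one component is known.

∘-known : ∀ {M N p s r} → N ⊢ p ↦ s → M ∘ᴹ N ⊢ p ↦ r → M ⊢ s ↦ r
∘-known {M} {N} d dr =
  let (s′ , d′ , d″) = ∘-elim dr in ↦-cong M (↦-functional N d′ d) (λ _ → refl) d″

,-knownʳ : ∀ {A B p t r} → B ⊢ p ↦ t → A ,ᴹ B ⊢ p ↦ r → ∃[ s ] (A ⊢ p ↦ s) × ⟨ s , t ⟩ ≗ r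
,-knownʳ {A} {B} d dr =
  let (s , t′ , dA , dB , e) = ,-elim dr
  in s , dA , λ i → trans (⟨,⟩-cong {s} (λ _ → refl) (↦-functional B d dB) i) (e i)

,-knownˡ : ∀ {A B p s r} → A ⊢ p ↦ s → A ,ᴹ B ⊢ p ↦ r → ∃[ t ] (B ⊢ p ↦ t) × ⟨ s , t ⟩ ≗ r
,-knownˡ {A} {B} d dr =
  let (s′ , t , dA , dB , e) = ,-elim dr
  in t , dB , λ i → trans (⟨,⟩-cong {q = t} (↦-functional A d dA) (λ _ → refl) i) (e i)

substᵢ : ∀ M {p p′ r} → p ≗ p′ → M ⊢ p ↦ r → M ⊢ p′ ↦ r
substᵢ M e = ↦-cong M e (λ _ → refl)

-- The machines behind composition and currying

-- The chain s = U ⟨ e′ , ⟨ p , q₁ ⟩ ⟩, t = T ⟨ s , q₂ ⟩, r = U ⟨ e , ⟨ t , q₃ ⟩ ⟩,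
-- computed from the parameter ⟨ e , e′ ⟩ and the argument
-- ⟨ p , ⟨ q₁ , ⟨ q₂ , q₃ ⟩ ⟩ ⟩.
module Composer (U T : Machine) where

  nameᶠ nameᵍ point trace₁ trace₂ trace₃ inner composer : Machine
  nameᶠ    = fstᴹ ∘ᴹ fstᴹ
  nameᵍ    = sndᴹ ∘ᴹ fstᴹ
  point    = fstᴹ ∘ᴹ sndᴹ
  trace₁   = fstᴹ ∘ᴹ sndᴹ ∘ᴹ sndᴹ
  trace₂   = fstᴹ ∘ᴹ sndᴹ ∘ᴹ sndᴹ ∘ᴹ sndᴹ
  trace₃   = sndᴹ ∘ᴹ sndᴹ ∘ᴹ sndᴹ ∘ᴹ sndᴹ
  inner    = U ∘ᴹ (nameᵍ ,ᴹ point ,ᴹ trace₁)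
  composer = U ∘ᴹ (nameᶠ ,ᴹ (T ∘ᴹ (inner ,ᴹ trace₂)) ,ᴹ trace₃)

  module _ {e e′ p q₁ q₂ q₃ : Baire} where

    input : Baire
    input = ⟨ ⟨ e , e′ ⟩ , ⟨ p , ⟨ q₁ , ⟨ q₂ , q₃ ⟩ ⟩ ⟩ ⟩

    private
      snd₂ : sndᴹ ∘ᴹ sndᴹ ⊢ input ↦ ⟨ q₁ , ⟨ q₂ , q₃ ⟩ ⟩
      snd₂ = ∘-intro snd-↦ snd-↦

      snd₃ : sndᴹ ∘ᴹ sndᴹ ∘ᴹ sndᴹ ⊢ input ↦ ⟨ q₂ , q₃ ⟩
      snd₃ = ∘-intro snd₂ snd-↦

      inner-input : nameᵍ ,ᴹ point ,ᴹ trace₁ ⊢ input ↦ ⟨ e′ , ⟨ p , q₁ ⟩ ⟩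
      inner-input = ,-intro (∘-intro fst-↦ snd-↦) (,-intro (∘-intro snd-↦ fst-↦) (∘-intro snd₂ fst-↦))

    composer-intro : ∀ {s t r} → U ⊢ ⟨ e′ , ⟨ p , q₁ ⟩ ⟩ ↦ s → T ⊢ ⟨ s , q₂ ⟩ ↦ t →
      U ⊢ ⟨ e , ⟨ t , q₃ ⟩ ⟩ ↦ r → composer ⊢ input ↦ r
    composer-intro d₁ d₂ d₃ = ∘-intro
      (,-intro (∘-intro fst-↦ fst-↦)
        (,-intro (∘-intro (,-intro (∘-intro inner-input d₁) (∘-intro snd₃ fst-↦)) d₂)
                 (∘-intro snd₃ snd-↦)))
      d₃

    composer-elim : ∀ {r} → composer ⊢ input ↦ r → ∃[ s ] ∃[ t ]
      (U ⊢ ⟨ e′ , ⟨ p , q₁ ⟩ ⟩ ↦ s) × (T ⊢ ⟨ s , q₂ ⟩ ↦ t) × (U ⊢ ⟨ e , ⟨ t , q₃ ⟩ ⟩ ↦ r)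
    composer-elim d =
      let (x , dx , d₃)   = ∘-elim d
          (y , dy , x≗)   = ,-knownˡ (∘-intro fst-↦ fst-↦) dx
          (t , dt , y≗)   = ,-knownʳ (∘-intro snd₃ snd-↦) dy
          (z , dz , d₂)   = ∘-elim dt
          (s , ds , z≗)   = ,-knownʳ (∘-intro snd₃ fst-↦) dz
      in s , t , ∘-known inner-input ds ,
         substᵢ T (λ i → sym (z≗ i)) d₂ ,
         substᵢ U (λ i → sym (trans (⟨,⟩-cong {e} (λ _ → refl) y≗ i) (x≗ i))) d₃

-- The chain t = T ⟨ u , q₁ ⟩, r = U ⟨ e , ⟨ ⟨ t , p ⟩ , q₂ ⟩ ⟩, computed from the
-- parameter ⟨ e , u ⟩ and the argument ⟨ p , ⟨ q₁ , q₂ ⟩ ⟩.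
module Currier (U T : Machine) where

  name second first trace₁ trace₂ currier : Machine
  name    = fstᴹ ∘ᴹ fstᴹ
  second  = sndᴹ ∘ᴹ fstᴹ
  first   = fstᴹ ∘ᴹ sndᴹ
  trace₁  = fstᴹ ∘ᴹ sndᴹ ∘ᴹ sndᴹ
  trace₂  = sndᴹ ∘ᴹ sndᴹ ∘ᴹ sndᴹ
  currier = U ∘ᴹ (name ,ᴹ ((T ∘ᴹ (second ,ᴹ trace₁)) ,ᴹ first) ,ᴹ trace₂)

  module _ {e u p q₁ q₂ : Baire} where

    input : Baire
    input = ⟨ ⟨ e , u ⟩ , ⟨ p , ⟨ q₁ , q₂ ⟩ ⟩ ⟩

    private
      snd₂ : sndᴹ ∘ᴹ sndᴹ ⊢ input ↦ ⟨ q₁ , q₂ ⟩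
      snd₂ = ∘-intro snd-↦ snd-↦

      tracer-input : second ,ᴹ trace₁ ⊢ input ↦ ⟨ u , q₁ ⟩
      tracer-input = ,-intro (∘-intro fst-↦ snd-↦) (∘-intro snd₂ fst-↦)

    currier-intro : ∀ {t r} → T ⊢ ⟨ u , q₁ ⟩ ↦ t → U ⊢ ⟨ e , ⟨ ⟨ t , p ⟩ , q₂ ⟩ ⟩ ↦ r → currier ⊢ input ↦ r
    currier-intro d₁ d₂ = ∘-intro
      (,-intro (∘-intro fst-↦ fst-↦)
        (,-intro (,-intro (∘-intro tracer-input d₁) (∘-intro snd-↦ fst-↦)) (∘-intro snd₂ snd-↦)))
      d₂

    currier-elim : ∀ {r} → currier ⊢ input ↦ r → ∃[ t ]
      (T ⊢ ⟨ u , q₁ ⟩ ↦ t) × (U ⊢ ⟨ e , ⟨ ⟨ t , p ⟩ , q₂ ⟩ ⟩ ↦ r)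
    currier-elim d =
      let (x , dx , d₂) = ∘-elim d
          (y , dy , x≗) = ,-knownˡ (∘-intro fst-↦ fst-↦) dx
          (z , dz , y≗) = ,-knownʳ (∘-intro snd₂ snd-↦) dy
          (t , dt , z≗) = ,-knownʳ (∘-intro snd-↦ fst-↦) dz
      in t , ∘-known tracer-input dt ,
         substᵢ U (λ i → sym (trans (⟨,⟩-cong {e} (λ _ → refl)
           (λ j → trans (⟨,⟩-cong {q = q₂} z≗ (λ _ → refl) j) (y≗ j)) i) (x≗ i))) d₂

-- Equality of multi-valued functions

module _ {X : RepresentedSpace a₁ a₂ a₃} {Y : RepresentedSpace b₁ b₂ b₃} where

  ≐-sym : (f : MultiFunction X Y ℓ₁) (g : MultiFunction X Y ℓ₂) → f ≐ g → g ≐ f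
  ≐-sym f g e x y = mk⇔ (from (e x y)) (to (e x y))

  ≐-trans : (f : MultiFunction X Y ℓ₁) (g : MultiFunction X Y ℓ₂) (h : MultiFunction X Y ℓ₃) →
            f ≐ g → g ≐ h → f ≐ h
  ≐-trans f g h e e′ x y = mk⇔ (to (e′ x y) ∘ to (e x y)) (from (e x y) ∘ from (e′ x y))

module _ {X : RepresentedSpace a₁ a₂ a₃} {Y : RepresentedSpace b₁ b₂ b₃}
         {Z : RepresentedSpace c₁ c₂ c₃} where

  ⊙-mono : (f : MultiFunction Y Z ℓ₁) (f′ : MultiFunction Y Z ℓ₂)
           (g : MultiFunction X Y ℓ₃) (g′ : MultiFunction X Y ℓ₄) →
           f ≐ f′ → g ≐ g′ → ∀ x z → value (f ⊙ g) x z → value (f′ ⊙ g′) x z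
  ⊙-mono f f′ g g′ e e′ x z ((y₀ , d) , i , y , h , h′) =
    (y₀ , to (e′ x y₀) d) ,
    (λ y₁ d₁ → let (z₁ , k) = i y₁ (from (e′ x y₁) d₁) in z₁ , to (e y₁ z₁) k) ,
    y , to (e′ x y) h , to (e y z) h′

  ⊙-cong : (f : MultiFunction Y Z ℓ₁) (f′ : MultiFunction Y Z ℓ₂)
           (g : MultiFunction X Y ℓ₃) (g′ : MultiFunction X Y ℓ₄) →
           f ≐ f′ → g ≐ g′ → f ⊙ g ≐ f′ ⊙ g′
  ⊙-cong f f′ g g′ e e′ x z =
    mk⇔ (⊙-mono f f′ g g′ e e′ x z)
        (⊙-mono f′ f g′ g (≐-sym f f′ e) (≐-sym g g′ e′) x z)

-- Names of composites and of sections

module Names (U : Machine) (X : RepresentedSpace a₁ a₂ a₃) (Y : RepresentedSpace b₁ b₂ b₃)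
             (Z : RepresentedSpace c₁ c₂ c₃) (traceable : EffectivelyTraceable Y) where

  open FunctionSpaces U
  private
    module X = RepresentedSpace X
    module Y = RepresentedSpace Y
    module Z = RepresentedSpace Z

    T : Machine
    T = proj₁ traceable

    -- Tracing turns a name of y into names of y, into all of them, and is
    -- defined on names only.
    trace : ∀ {p y} → Y.δ p y → ∀ q → ∃[ r ] (T ⊢ ⟨ p , q ⟩ ↦ r) × Y.δ r y
    trace {p} {y} h q = let (r , d) = from (proj₁ (proj₂ traceable) p q) (y , h)
                        in r , d , to (proj₂ (proj₂ traceable) p y h r) (q , d)

    traced : ∀ {p y r} → Y.δ p y → Y.δ r y → ∃[ q ] T ⊢ ⟨ p , q ⟩ ↦ r
    traced {p} {y} {r} h k = from (proj₂ (proj₂ traceable) p y h r) k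

    named : ∀ {p q r} → T ⊢ ⟨ p , q ⟩ ↦ r → ∃[ y ] Y.δ p y
    named {p} {q} {r} d = to (proj₁ (proj₂ traceable) p q) (r , d)

  composer currier : Machine
  composer = Composer.composer U T
  currier  = Currier.currier U T

  open Composer U T using (composer-intro; composer-elim)
  open Currier U T using (currier-intro; currier-elim)

  -- Every sequence is, up to pointwise equality, a triple of parameters.
  split₃ : Baire → Baire
  split₃ q = ⟨ evens q , ⟨ evens (odds q) , odds (odds q) ⟩ ⟩

  split₃-≗ : ∀ q → split₃ q ≗ q
  split₃-≗ q i = trans (⟨,⟩-cong {evens q} (λ _ → refl) (pair-split (odds q)) i) (pair-split q i)

  argument : ∀ {e p q q′ r} → q ≗ q′ → Φ e ⟨ p , q ⟩ r → Φ e ⟨ p , q′ ⟩ r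
  argument {e} {p} q≗ = substᵢ U (⟨,⟩-cong {e} (λ _ → refl) (⟨,⟩-cong {p} (λ _ → refl) q≗))

  -- s is a name of the partial function computed by M with parameter c.
  Represents : Machine → Baire → Baire → Set
  Represents M c s = ∀ q r → (Φ s q r) ⇔ (M ⊢ ⟨ c , q ⟩ ↦ r)

  module _ {e e′ s : Baire} (S : Represents composer ⟨ e , e′ ⟩ s) where

    private
      F = Φ[_] Y Z e
      G = Φ[_] X Y e′
      H = Φ[_] X Z s

      decompose : ∀ {p q₁ q₂ q₃ r} → Φ s ⟨ p , ⟨ q₁ , ⟨ q₂ , q₃ ⟩ ⟩ ⟩ r → ∃[ t ] ∃[ u ]
            (Φ e′ ⟨ p , q₁ ⟩ t) × (T ⊢ ⟨ t , q₂ ⟩ ↦ u) × (Φ e ⟨ u , q₃ ⟩ r)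
      decompose d = composer-elim (to (S _ _) d)

      assemble : ∀ {p q₁ q₂ q₃ t u r} → Φ e′ ⟨ p , q₁ ⟩ t → T ⊢ ⟨ t , q₂ ⟩ ↦ u → Φ e ⟨ u , q₃ ⟩ r →
              Φ s ⟨ p , ⟨ q₁ , ⟨ q₂ , q₃ ⟩ ⟩ ⟩ r
      assemble d₁ d₂ d₃ = from (S _ _) (composer-intro d₁ d₂ d₃)

      -- A given name of a value of g can be traced to any other name of it. So
      -- if the chain is defined for all parameters, then f is defined at
      -- every value of g.
      analyse : ∀ x z → value H x z → value (Φ[_] Y Z e ⊙ Φ[_] X Y e′) x z
      analyse x z (tot , p₀ , q₀ , r₀ , hp , φ , hz) =
        let (t , u , d₁ , d₂ , d₃) = decompose (argument {s} {p₀} (λ i → sym (split₃-≗ q₀ i)) φ)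
            (y , ht)  = named d₂
            g         = tot-G , p₀ , evens q₀ , t , hp , d₁ , ht
            (_ , d , hu) = trace ht (evens (odds q₀))
            hu′       = Y.δ-cong (↦-functional T d d₂) Y.refl hu
        in (y , g) , inc , y , g , tot-F y g , u , odds (odds q₀) , r₀ , hu′ , d₃ , hz
        where
        tot-G : ∀ p q → X.δ p x → ∃[ t ] Φ e′ ⟨ p , q ⟩ t × (∃[ y ] Y.δ t y)
        -- Only the first component of the triple matters.
        tot-G p q h = let (_ , φ , _) = tot p ⟨ q , ⟨ q , q ⟩ ⟩ h
                          (t , _ , d₁ , d₂ , _) = decompose φ
                      -- T is defined on names only.
                      in t , d₁ , named d₂

        tot-F : ∀ y → value G x y → ∀ u q → Y.δ u y → ∃[ r ] Φ e ⟨ u , q ⟩ r × (∃[ z ] Z.δ r z)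
        tot-F y (_ , p , q₁ , t , h , d , ht) u q hu =
          let (q₂ , k)                  = traced ht hu
              (r , φ , hr)              = tot p ⟨ q₁ , ⟨ q₂ , q ⟩ ⟩ h
              (t′ , u′ , d₁ , d₂ , d₃) = decompose φ
              t≗ = ↦-functional U d₁ d
              u≗ = ↦-functional T (substᵢ T (⟨,⟩-cong {q = q₂} t≗ (λ _ → refl)) d₂) k
          in r , substᵢ U (⟨,⟩-cong {e} (λ _ → refl) (⟨,⟩-cong {q = q} u≗ (λ _ → refl))) d₃ , hr

        inc : ∀ y → value G x y → dom F y
        inc y g@(_ , _ , _ , t , _ , _ , ht) =
          let (r , φ , z′ , hz′) = tot-F y g t t ht
          in z′ , tot-F y g , t , t , r , ht , φ , hz′

      synthesise : ∀ x z → value (Φ[_] Y Z e ⊙ Φ[_] X Y e′) x z → value H x z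
      synthesise x z (_ , inc , y , (tot-G , p , q₁ , t , hp , d₁ , ht) , (_ , u , q₃ , r , hu , d₃ , hr)) =
        tot ,
        (let (q₂ , d₂) = traced ht hu
         in p , ⟨ q₁ , ⟨ q₂ , q₃ ⟩ ⟩ , r , hp , assemble d₁ d₂ d₃ , hr)
        where
        tot : ∀ p q → X.δ p x → ∃[ r ] Φ s ⟨ p , q ⟩ r × (∃[ z ] Z.δ r z)
        tot p q h =
          let (t , d₁ , y′ , ht)   = tot-G p (evens q) h
              (u , d₂ , hu)        = trace ht (evens (odds q))
              (_ , tot-F , _)      = inc y′ (tot-G , p , evens q , t , h , d₁ , ht)
              (r , d₃ , hr)        = tot-F u (odds (odds q)) hu
          in r , argument {s} {p} (split₃-≗ q) (assemble d₁ d₂ d₃) , hr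

    composer-names : Φ[_] X Z s ≐ Φ[_] Y Z e ⊙ Φ[_] X Y e′
    composer-names x z = mk⇔ (analyse x z) (synthesise x z)

  module _ {e u s : Baire} {y : Y.Carrier} (hu : Y.δ u y) (S : Represents currier ⟨ e , u ⟩ s) where

    private
      F = Φ[_] (Y ×ʳ X) Z e
      H = Φ[_] X Z s

      decompose : ∀ {p q₁ q₂ r} → Φ s ⟨ p , ⟨ q₁ , q₂ ⟩ ⟩ r → ∃[ t ]
            (T ⊢ ⟨ u , q₁ ⟩ ↦ t) × (Φ e ⟨ ⟨ t , p ⟩ , q₂ ⟩ r)
      decompose d = currier-elim (to (S _ _) d)

      assemble : ∀ {p q₁ q₂ t r} → T ⊢ ⟨ u , q₁ ⟩ ↦ t → Φ e ⟨ ⟨ t , p ⟩ , q₂ ⟩ r → Φ s ⟨ p , ⟨ q₁ , q₂ ⟩ ⟩ r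
      assemble d₁ d₂ = from (S _ _) (currier-intro d₁ d₂)

      first : ∀ {w w′ q r} → w ≗ w′ → Φ e ⟨ w , q ⟩ r → Φ e ⟨ w′ , q ⟩ r
      first {q = q} w≗ = substᵢ U (⟨,⟩-cong {e} (λ _ → refl) (⟨,⟩-cong {q = q} w≗ (λ _ → refl)))

      -- A name of (y , x) is a pair of a name of y, which has the form T ⟨ u , q₁ ⟩,
      -- and a name of x.
      analyse : ∀ x z → value H x z → value F (y , x) z
      analyse x z (tot , p , q , r , hp , φ , hr) =
        (λ { w q (u′ , p , w≗ , hu′ , hp) →
           let (q₁ , k)       = traced hu hu′
               (r , φ , hr)   = tot p ⟨ q₁ , q ⟩ hp
               (t , d₁ , d₂)  = decompose φ
               t≗ = ↦-functional T d₁ k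
           in r , first (λ i → trans (⟨,⟩-cong {q = p} t≗ (λ _ → refl) i) (sym (w≗ i))) d₂ , hr }) ,
        (let (t , d₁ , d₂)  = decompose (argument {s} {p} (λ i → sym (pair-split q i)) φ)
             (_ , d , ht)   = trace hu (evens q)
             ht′            = Y.δ-cong (↦-functional T d d₁) Y.refl ht
         in ⟨ t , p ⟩ , odds q , r , (t , p , (λ _ → refl) , ht′ , hp) , d₂ , hr)

      synthesise : ∀ x z → value F (y , x) z → value H x z
      synthesise x z (tot , w , q , r , (u′ , p , w≗ , hu′ , hp) , φ , hr) =
        (λ p q hp →
           let (t , d₁ , ht) = trace hu (evens q)
               (r , d₂ , hr) = tot ⟨ t , p ⟩ (odds q) (t , p , (λ _ → refl) , ht , hp)
           in r , argument {s} {p} (pair-split q) (assemble d₁ d₂) , hr) ,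
        (let (q₁ , k) = traced hu hu′
         in p , ⟨ q₁ , q ⟩ , r , hp , assemble k (first w≗ φ) , hr)

    currier-names : Φ[_] X Z s ≐ section Y X (Φ[_] (Y ×ʳ X) Z e) y
    currier-names x z = mk⇔ (analyse x z) (synthesise x z)

-- Computability of composition and of currying

module Operations (U : Machine) (universal : Universal U)
  (X : RepresentedSpace a₁ a₂ a₃) (Y : RepresentedSpace b₁ b₂ b₃) (Z : RepresentedSpace c₁ c₂ c₃)
  (traceable : EffectivelyTraceable Y) where

  open FunctionSpaces U
  open Names U X Y Z traceable
  private
    module X = RepresentedSpace X
    module Y = RepresentedSpace Y
    module 𝓜XZ = RepresentedSpace (𝓜 X Z)

  -- smn M computes, from a parameter p of M, a name of the partial function
  -- computed by M with this parameter.
  smn : Machine → Machine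
  smn M = proj₁ (universal M)

  parameter : Machine → Baire → Baire
  parameter M p = proj₁ (proj₂ (universal M) p)

  smn-↦ : ∀ M p → smn M ⊢ p ↦ parameter M p
  smn-↦ M p = proj₁ (proj₂ (proj₂ (universal M) p))

  parameter-represents : ∀ M p → Represents M p (parameter M p)
  parameter-represents M p = proj₂ (proj₂ (proj₂ (universal M) p))

  -- The strongly continuous function with name s.
  function : Baire → ∣ 𝓜 X Z ∣
  function s = Φ[_] X Z s , s , λ x z → mk⇔ (λ h → h) (λ h → h)

  compositionName : Baire → Baire → Baire
  compositionName e e′ = parameter composer ⟨ e , e′ ⟩

  compositionName-⊙ : ∀ {e e′}
    (f : MultiFunction Y Z (b₃ ⊔ c₁ ⊔ c₃)) (g : MultiFunction X Y (a₃ ⊔ b₁ ⊔ b₃)) →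
    f ≐ Φ[_] Y Z e → g ≐ Φ[_] X Y e′ →
    Φ[_] X Z (compositionName e e′) ≐ f ⊙ g
  compositionName-⊙ {e} {e′} f g f≐ g≐ =
    ≐-trans (Φ[_] X Z (compositionName e e′)) (Φ[_] Y Z e ⊙ Φ[_] X Y e′) (f ⊙ g)
      (composer-names {e} {e′} (parameter-represents composer ⟨ e , e′ ⟩))
      (⊙-cong (Φ[_] Y Z e) f (Φ[_] X Y e′) g (≐-sym f (Φ[_] Y Z e) f≐) (≐-sym g (Φ[_] X Y e′) g≐))

  -- The name of the composite is chosen by means of the given names of f and g.
  compose : ∣ 𝓜 Y Z ∣ → ∣ 𝓜 X Y ∣ → ∣ 𝓜 X Z ∣
  compose (_ , e , _) (_ , e′ , _) = function (compositionName e e′)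

  compose-⊙ : ∀ f g → proj₁ (compose f g) ≐ proj₁ f ⊙ proj₁ g
  compose-⊙ (f , e , f≐) (g , e′ , g≐) = compositionName-⊙ f g f≐ g≐

  composition : 𝓜 Y Z ×ʳ 𝓜 X Y ⟶ 𝓜 X Z
  composition = record
    { to   = λ (f , g) → compose f g
    ; cong = λ { {f , g} {f′ , g′} (f≐f′ , g≐g′) →
        ≐-trans (proj₁ (compose f g)) (proj₁ f ⊙ proj₁ g) (proj₁ (compose f′ g′)) (compose-⊙ f g)
          (≐-trans (proj₁ f ⊙ proj₁ g) (proj₁ f′ ⊙ proj₁ g′) (proj₁ (compose f′ g′))
            (⊙-cong (proj₁ f) (proj₁ f′) (proj₁ g) (proj₁ g′) f≐f′ g≐g′)
            (≐-sym (proj₁ (compose f′ g′)) (proj₁ f′ ⊙ proj₁ g′) (compose-⊙ f′ g′))) }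
    }

  composition-computable : Computable (graph (𝓜 Y Z ×ʳ 𝓜 X Y) (𝓜 X Z) composition)
  composition-computable = smn composer , λ { p (f , g) (e , e′ , p≗ , f≐ , g≐) _ →
    compositionName e e′ ,
    substᵢ (smn composer) (λ i → sym (p≗ i)) (smn-↦ composer ⟨ e , e′ ⟩) ,
    compose f g ,
    ≐-trans (proj₁ (compose f g)) (proj₁ f ⊙ proj₁ g) (Φ[_] X Z (compositionName e e′))
      (compose-⊙ f g)
      (≐-sym (Φ[_] X Z (compositionName e e′)) (proj₁ f ⊙ proj₁ g)
        (compositionName-⊙ (proj₁ f) (proj₁ g) f≐ g≐)) ,
    𝓜XZ.refl {compose f g} }

  sectionName : Baire → Baire → Baire
  sectionName e u = parameter currier ⟨ e , u ⟩

  sectionName-section : ∀ {e u y} (f : MultiFunction (Y ×ʳ X) Z (a₃ ⊔ b₃ ⊔ c₁ ⊔ c₃)) →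
    f ≐ Φ[_] (Y ×ʳ X) Z e → Y.δ u y →
    Φ[_] X Z (sectionName e u) ≐ section Y X f y
  sectionName-section {e} {u} {y} f f≐ hu =
    ≐-trans (Φ[_] X Z (sectionName e u)) (section Y X (Φ[_] (Y ×ʳ X) Z e) y) (section Y X f y)
      (currier-names {e} {u} hu (parameter-represents currier ⟨ e , u ⟩))
      (λ x z → mk⇔ (from (f≐ (y , x) z)) (to (f≐ (y , x) z)))

  -- The name of the section at y is chosen by means of some name of y; by
  -- sectionName-section the section does not depend on this choice.
  curryAt : ∣ 𝓜 (Y ×ʳ X) Z ∣ → ∣ Y ∣ → ∣ 𝓜 X Z ∣
  curryAt (_ , e , _) y = function (sectionName e (proj₁ (Y.δ-surjective y)))

  curryAt-section : ∀ f y → proj₁ (curryAt f y) ≐ section Y X (proj₁ f) y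
  curryAt-section (f , e , f≐) y = sectionName-section f f≐ (proj₂ (Y.δ-surjective y))

  curryAt-cong : ∀ f g {y y′} → proj₁ f ≐ proj₁ g → y Y.≈ y′ → proj₁ (curryAt f y) ≐ proj₁ (curryAt g y′)
  curryAt-cong f g {y} {y′} f≐g y≈y′ =
    ≐-trans (proj₁ (curryAt f y)) (section Y X (proj₁ f) y) (proj₁ (curryAt g y′)) (curryAt-section f y)
      (≐-trans (section Y X (proj₁ f) y) (section Y X (proj₁ g) y′) (proj₁ (curryAt g y′))
        (λ x z → mk⇔
          (λ h → value-cong (proj₁ g) (y≈y′ , X.refl) (RepresentedSpace.refl Z) (to (f≐g (y , x) z) h))
          (λ h → from (f≐g (y , x) z) (value-cong (proj₁ g) (Y.sym y≈y′ , X.refl) (RepresentedSpace.refl Z) h)))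
        (≐-sym (proj₁ (curryAt g y′)) (section Y X (proj₁ g) y′) (curryAt-section g y′)))

  curryFunc : ∣ 𝓜 (Y ×ʳ X) Z ∣ → (Y ⟶ 𝓜 X Z)
  curryFunc f = record
    { to   = curryAt f
    ; cong = curryAt-cong f f (RepresentedSpace.refl (𝓜 (Y ×ʳ X) Z) {f})
    }

  -- A second application of universality: the map from u to sectionName e u has
  -- a name computable from e.
  curryName : Baire → Baire
  curryName e = parameter (smn currier) e

  curryName-realizes : ∀ {e} f → proj₁ f ≐ Φ[_] (Y ×ʳ X) Z e →
    Realizes (Φ (curryName e)) (graph Y (𝓜 X Z) (curryFunc f))
  curryName-realizes {e} f f≐ u y hu _ =
    sectionName e u ,
    from (parameter-represents (smn currier) e u (sectionName e u)) (smn-↦ currier ⟨ e , u ⟩) ,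
    curryAt f y ,
    ≐-trans (proj₁ (curryAt f y)) (section Y X (proj₁ f) y) (Φ[_] X Z (sectionName e u))
      (curryAt-section f y)
      (≐-sym (Φ[_] X Z (sectionName e u)) (section Y X (proj₁ f) y) (sectionName-section (proj₁ f) f≐ hu)) ,
    𝓜XZ.refl {curryAt f y}

  currying : 𝓜 (Y ×ʳ X) Z ⟶ 𝓒 Y (𝓜 X Z)
  currying = record
    { to   = λ { f@(_ , e , f≐) → curryFunc f , curryName e , curryName-realizes f f≐ }
    ; cong = λ { {f} {g} f≐g y → curryAt-cong f g f≐g Y.refl }
    }

  currying-computable : Computable (graph (𝓜 (Y ×ʳ X) Z) (𝓒 Y (𝓜 X Z)) currying)
  currying-computable = smn (smn currier) , λ e f f≐ _ →
    curryName e , smn-↦ (smn currier) e ,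
    (currying ⟨$⟩ f) , curryName-realizes f f≐ ,
    RepresentedSpace.refl (𝓒 Y (𝓜 X Z)) {currying ⟨$⟩ f}

proposition7p9 : ∀ {a₁ a₂ a₃ b₁ b₂ b₃ c₁ c₂ c₃}
    (U : Machine) → Universal U →
    (X : RepresentedSpace a₁ a₂ a₃) (Y : RepresentedSpace b₁ b₂ b₃)
    (Z : RepresentedSpace c₁ c₂ c₃) → EffectivelyTraceable Y →
    let open FunctionSpaces U in
    (Σ[ comp ∈ (𝓜 Y Z ×ʳ 𝓜 X Y ⟶ 𝓜 X Z) ]
    (∀ f g → proj₁ (comp ⟨$⟩ (f , g)) ≐ proj₁ f ⊙ proj₁ g) ×
    Computable (graph (𝓜 Y Z ×ʳ 𝓜 X Y) (𝓜 X Z) comp))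
    ×
    (Σ[ curry ∈ (𝓜 (Y ×ʳ X) Z ⟶ 𝓒 Y (𝓜 X Z)) ]
    (∀ f y → proj₁ (proj₁ (curry ⟨$⟩ f) ⟨$⟩ y) ≐ section Y X (proj₁ f) y) ×
    Computable (graph (𝓜 (Y ×ʳ X) Z) (𝓒 Y (𝓜 X Z)) curry))
proposition7p9 U universal X Y Z traceable =
  (composition , compose-⊙ , composition-computable) ,
  (currying , curryAt-section , currying-computable)
  where open Operations U universal X Y Z traceable
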